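{- We have $c_0^\times \leq_B E^H_{\mathrm{Diff}([0,1])}$.
   Context: $\mathcal{H}^+([0,1])$ is the group of increasing homeomorphisms of $[0,1]$ onto itself. $\mathrm{Diff}([0,1]) = \{f \in \mathcal{H}^+([0,1]) : f' \in \mathcal{C}([0,1]),\ (f^{ -1})' \in \mathcal{C}([0,1])\}$ (one-sided derivatives at the endpoints). $\mathcal{F}([0,1])$ is the space of closed subsets of $[0,1]$ with the Vietoris topology, and $E^H_{\mathrm{Diff}([0,1])}$ is the equivalence relation on $\mathcal{F}([0,1])$ given by: $F_1\, E^H_{\mathrm{Diff}([0,1])}\, F_2$ iff there is $g \in \mathrm{Diff}([0,1])$ with $g(F_1) = F_2$. $c_0^\times$ is the equivalence relation on $(0,1)^{\mathbb{N}}$ given by $(x_n)\, c_0^\times\, (y_n)$ iff $\lim_{n\to\infty} x_n/y_n = 1$. For equivalence relations $E, F$ on standard Borel spaces $X, Y$: $E \leq_B F$ means there is a Borel map $f: X \to Y$ with $x E y \iff f(x) F f(y)$ for all $x,y\in X$. -}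

module Defs where

open import Algebra.Bundles using (CommutativeRing)
open import Algebra.Core using (Op₁)
import Algebra.Construct.NaturalChoice.Max as Max
open import Data.List.Base using (List)
open import Data.List.Relation.Unary.All using (All)
open import Data.Nat.Base as ℕ using (ℕ)
open import Data.Product.Base using (Σ; Σ-syntax; ∃; _×_; _,_; proj₁; proj₂)
open import Data.Sum.Base using (_⊎_; inj₁; inj₂)
open import Function.Base using (_∘_)
open import Function.Bundles using (Func; Inverse; _⇔_)
open import Level using (Level; 0ℓ; _⊔_) renaming (suc to lsuc)
open import Relation.Binary.Bundles using (Setoid; TotalOrder)
open import Relation.Binary.Core using (Rel)
open import Relation.Binary.Structures using (IsTotalOrder)
import Relation.Binary.Construct.NonStrictToStrict as Strict
import Relation.Binary.Construct.On as On
open import Relation.Nullary.Negation using (¬_)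
open import Relation.Unary
  using (Pred; Satisfiable; _∈_; _⊆_; _≐_; _≬_; _⊢_; ∁; ⋃)

-- The real numbers, given axiomatically.  Equality is a setoid equality so
-- that, under excluded middle, the usual constructions (e.g. Cauchy sequences
-- of rationals) are instances without needing quotient types.
record CompleteOrderedField : Set₁ where
  infix 4 _≤_
  infix 9 _⁻¹
  field
    commutativeRing : CommutativeRing 0ℓ 0ℓ

  open CommutativeRing commutativeRing public

  field
    _≤_          : Rel Carrier 0ℓ
    _⁻¹          : Op₁ Carrier
    isTotalOrder : IsTotalOrder _≈_ _≤_
    0≉1          : ¬ (0# ≈ 1#)
    -- The value of 0# ⁻¹ is left unspecified.
    *-inverseʳ   : ∀ x → ¬ (x ≈ 0#) → x * x ⁻¹ ≈ 1#
    +-monoˡ-≤    : ∀ {x y} z → x ≤ y → x + z ≤ y + z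
    *-nonNeg     : ∀ {x y} → 0# ≤ x → 0# ≤ y → 0# ≤ x * y

  UpperBound : Pred Carrier 0ℓ → Pred Carrier 0ℓ
  UpperBound P b = ∀ x → x ∈ P → x ≤ b

  field
    supremum : (P : Pred Carrier 0ℓ) → Satisfiable P → Satisfiable (UpperBound P) →
               Σ[ s ∈ Carrier ] UpperBound P s × (∀ b → UpperBound P b → s ≤ b)

  totalOrder : TotalOrder 0ℓ 0ℓ 0ℓ
  totalOrder = record { isTotalOrder = isTotalOrder }

  open Strict _≈_ _≤_ public using (_<_)

  private module Maximum = Max totalOrder

  ∣_∣ : Op₁ Carrier
  ∣ x ∣ = x Maximum.⊔ (- x)

-- A topological space presented by a subbasis.
record Space (c i : Level) : Set (lsuc (c ⊔ i)) where
  field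
    setoid   : Setoid c 0ℓ
    Index    : Set i
    subbasis : Index → Pred (Setoid.Carrier setoid) 0ℓ

  open Setoid setoid public

  -- U is a union of finite intersections of subbasic sets, expressed pointwise:
  -- every point of U has such an intersection as a neighbourhood inside U.  The
  -- empty list gives the whole space.
  Open : Pred (Pred Carrier 0ℓ) (c ⊔ i)
  Open U = ∀ {x} → x ∈ U → Σ[ js ∈ List Index ]
    All (λ j → x ∈ subbasis j) js × (∀ {y} → All (λ j → y ∈ subbasis j) js → y ∈ U)

  data Borel : Pred (Pred Carrier 0ℓ) (lsuc 0ℓ ⊔ c ⊔ i) where
    open-set   : ∀ {U} → Open U → Borel U
    complement : ∀ {B} → Borel B → Borel (∁ B)
    union      : ∀ {B : ℕ → Pred Carrier 0ℓ} → (∀ n → Borel (B n)) → Borel (⋃ ℕ B)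
    -- Subsets are predicates; extensionally equal ones are the same subset.
    extensional : ∀ {A B} → A ≐ B → Borel A → Borel B

module _ {c i c′ i′ : Level} (X : Space c i) (Y : Space c′ i′) where
  private
    module X = Space X
    module Y = Space Y

  BorelMap : (X.Carrier → Y.Carrier) → Set (lsuc 0ℓ ⊔ c ⊔ i ⊔ c′ ⊔ i′)
  BorelMap f = ∀ {B} → Y.Borel B → X.Borel (f ⊢ B)

-- [ X , E ]≤B[ Y , F ] is E ≤_B F for relations E on X and F on Y.
[_,_]≤B[_,_] : ∀ {c i c′ i′ e e′} →
               (X : Space c i) → Rel (Space.Carrier X) e →
               (Y : Space c′ i′) → Rel (Space.Carrier Y) e′ →
               Set (lsuc 0ℓ ⊔ c ⊔ i ⊔ c′ ⊔ i′ ⊔ e ⊔ e′)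
[ X , E ]≤B[ Y , F ] =
  Σ[ f ∈ Func (Space.setoid X) (Space.setoid Y) ]
    BorelMap X Y (Func.to f) ×
    (∀ x y → E x y ⇔ F (Func.to f x) (Func.to f y))

subspace : ∀ {c i} (X : Space c i) → Pred (Space.Carrier X) 0ℓ → Space c i
subspace X P = record
  { setoid   = On.setoid {B = Σ X.Carrier P} X.setoid proj₁
  ; Index    = X.Index
  ; subbasis = λ j → proj₁ ⊢ X.subbasis j
  }
  where module X = Space X

-- Countable power with the product topology.
_^ℕ : ∀ {c i} → Space c i → Space c (lsuc 0ℓ ⊔ c ⊔ i)
X ^ℕ = record
  { setoid   = record
    { Carrier       = ℕ → X.Carrier
    ; _≈_           = λ x y → ∀ n → x n X.≈ y n
    ; isEquivalence = record
      { refl  = λ n → X.refl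
      ; sym   = λ x≈y n → X.sym (x≈y n)
      ; trans = λ x≈y y≈z n → X.trans (x≈y n) (y≈z n)
      }
    }
  ; Index    = ℕ × ∃ X.Open
  ; subbasis = λ (n , U , _) x → x n ∈ U
  }
  where module X = Space X

record ClosedSet {c i} (X : Space c i) : Set (lsuc 0ℓ ⊔ c ⊔ i) where
  field
    points : Pred (Space.Carrier X) 0ℓ
    closed : Space.Open X (∁ points)

open ClosedSet public

-- The closed subsets of X (the empty set included) with the Vietoris topology,
-- generated by { F ∣ F ⊆ U } and { F ∣ F ∩ U ≠ ∅ } for U open in X.
Vietoris : ∀ {i} → Space 0ℓ i → Space (lsuc 0ℓ ⊔ i) (lsuc 0ℓ ⊔ i)
Vietoris X = record
  { setoid   = record
    { Carrier       = ClosedSet X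
    ; _≈_           = λ F G → points F ≐ points G
    ; isEquivalence = record
      { refl  = (λ p → p) , (λ p → p)
      ; sym   = λ (p , q) → q , p
      ; trans = λ (p , q) (r , s) → (λ z → r (p z)) , (λ z → q (s z))
      }
    }
  ; Index    = ∃ X.Open ⊎ ∃ X.Open
  ; subbasis = λ where
      (inj₁ (U , _)) F → points F ⊆ U
      (inj₂ (U , _)) F → points F ≬ U
  }
  where module X = Space X

module Reals (R : CompleteOrderedField) where
  open CompleteOrderedField R

  ℝ : Space 0ℓ 0ℓ
  ℝ = record
    { setoid   = setoid
    ; Index    = Carrier × Carrier
    ; subbasis = λ (a , b) x → a < x × x < b
    }

  [0,1] : Space 0ℓ 0ℓ
  [0,1] = subspace ℝ (λ x → 0# ≤ x × x ≤ 1#)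

  ⟨0,1⟩ : Space 0ℓ 0ℓ
  ⟨0,1⟩ = subspace ℝ (λ x → 0# < x × x < 1#)

  𝓕[0,1] : Space (lsuc 0ℓ) (lsuc 0ℓ)
  𝓕[0,1] = Vietoris [0,1]

  private
    I : Set
    I = Space.Carrier [0,1]

  c₀× : Rel (Space.Carrier (⟨0,1⟩ ^ℕ)) 0ℓ
  c₀× x y = ∀ ε → 0# < ε → Σ[ N ∈ ℕ ] (∀ n → N ℕ.≤ n →
    ∣ proj₁ (x n) * proj₁ (y n) ⁻¹ - 1# ∣ < ε)

  Continuous : (I → Carrier) → Set
  Continuous f = ∀ x ε → 0# < ε → Σ[ δ ∈ Carrier ] 0# < δ ×
    (∀ y → ∣ proj₁ y - proj₁ x ∣ < δ → ∣ f y - f x ∣ < ε)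

  -- As y ranges over [0,1] only, this is a one-sided derivative at 0 and 1.
  HasDerivativeAt : (I → Carrier) → I → Carrier → Set
  HasDerivativeAt f x d = ∀ ε → 0# < ε → Σ[ δ ∈ Carrier ] 0# < δ ×
    (∀ y → ¬ (proj₁ y ≈ proj₁ x) → ∣ proj₁ y - proj₁ x ∣ < δ →
      ∣ (f y - f x) * (proj₁ y - proj₁ x) ⁻¹ - d ∣ < ε)

  C¹ : (I → Carrier) → Set
  C¹ f = Σ[ f′ ∈ (I → Carrier) ] (∀ x → HasDerivativeAt f x (f′ x)) × Continuous f′

  record 𝓗⁺ : Set where
    field
      bijection : Inverse (Space.setoid [0,1]) (Space.setoid [0,1])

    open Inverse bijection public using (to; from)

    field
      increasing      : ∀ x y → proj₁ x < proj₁ y → proj₁ (to x) < proj₁ (to y)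
      to-continuous   : Continuous (proj₁ ∘ to)
      from-continuous : Continuous (proj₁ ∘ from)

  record Diff : Set where
    field
      homeomorphism : 𝓗⁺

    open 𝓗⁺ homeomorphism public

    field
      to-C¹   : C¹ (proj₁ ∘ to)
      from-C¹ : C¹ (proj₁ ∘ from)

  image : (I → I) → Pred I 0ℓ → Pred I 0ℓ
  image g A y = Σ[ x ∈ I ] x ∈ A × proj₁ (g x) ≈ proj₁ y

  E^H-Diff : Rel (Space.Carrier 𝓕[0,1]) 0ℓ
  E^H-Diff F₁ F₂ = Σ[ g ∈ Diff ] image (Diff.to g) (points F₁) ≐ points F₂

{-# OPTIONS --safe #-}

module Submission where

open import Defs
import Algebra.Construct.NaturalChoice.Max as Maximum
import Algebra.Properties.AbelianGroup as AbelianGroupProperties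
import Algebra.Properties.Ring as RingProperties
import Algebra.Properties.Semiring.Mult.TCOptimised as Mult
import Algebra.Solver.Ring as RingSolver
open import Algebra.Solver.Ring.AlmostCommutativeRing
  using (fromCommutativeRing; _-Raw-AlmostCommutative⟶_)
open import Axiom.ExcludedMiddle using (ExcludedMiddle)
open import Data.Empty using (⊥; ⊥-elim)
open import Data.Integer.Base as ℤ using (ℤ; +_; -[1+_])
import Data.Integer.Properties as ℤ
open import Data.List.Base using (List; []; _∷_; _++_)
open import Data.List.Relation.Unary.All using (All; []; _∷_)
import Data.List.Relation.Unary.All.Properties as All
open import Data.Maybe.Base using (Maybe; just; nothing)
open import Data.Nat.Base as ℕ using (ℕ; zero; suc)
import Data.Nat.Properties as ℕ
open import Data.Product.Base using (Σ; Σ-syntax; ∃; _×_; _,_; proj₁; proj₂)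
open import Data.Sum.Base using (_⊎_; inj₁; inj₂)
open import Function.Bundles using (Inverse; mk⇔)
open import Level using (Level; 0ℓ)
open import Relation.Binary.Bundles using (TotalOrder)
open import Relation.Binary.Definitions using (tri<; tri≈; tri>)
import Relation.Binary.Properties.TotalOrder as TotalOrderProperties
open import Relation.Binary.PropositionalEquality.Core as ≡ using (_≡_)
import Relation.Binary.Reasoning.Setoid as SetoidReasoning
open import Relation.Nullary using (¬_; yes; no)
open import Relation.Unary using (Pred; _∈_; _≐_; ∁; _⊢_)

-- A sequence x is encoded by the closed set of nodes, decreasing to 0, whose n-th
-- block, at scale h = 1/2^(n+3), has the gaps (2 - x n) h, (2 - x n) h, x n h, x n h.
-- The blocks themselves lie at places that do not depend on x.
--
-- A diffeomorphism carrying one such set onto another respects the order, so it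
-- carries nodes to nodes of the same index.  It fixes the block ends, hence has
-- derivative 1 at 0, and as its derivative is continuous the mean value inequality
-- makes the ratios of corresponding gaps tend to 1.
--
-- Conversely, nodes p k can be carried to nodes q k by maps that are Möbius between
-- consecutive nodes, provided there are weights w k → 1, to become square roots of
-- the derivative at the nodes, with q k - q (k + 1) = (p k - p (k + 1)) w k w (k + 1).
-- Bisecting both parts of each block is what makes such weights exist: they are 1,
-- (2 - y n) / (2 - x n), 1, y n / x n.  On each piece the square root u of the
-- derivative satisfies s - s′ = (t - t′) u u′ for points (t , s), (t′ , s′) of the
-- graph, which gives differentiability; the inverse is obtained from w⁻¹.

-- Interpolating linearly would make the derivative jump at the nodes. Möbius pieces can be given
-- matching derivatives there, and only the products w k w (k + 1) are then prescribed. With an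
-- arbitrary ratio r k of gaps at each step this would force w (k + 1) = r k / w k, and such weights
-- need not tend to 1 even if the r k do. Two successive gaps with the same ratio r admit the
-- weights 1, r, 1, so the recursion restarts at every second node.
--
-- The block ends can stay fixed only if a second pair of gaps compensates for the pair x n h. That
-- pair has length (2 - x n) h and not (1 - x n) h: if x n and y n tend to 1, then (1 - y n) / (1 -
-- x n) need not tend to 1 although x n / y n does. Since 2 - x n stays above x n, its relative
-- change is at most that of x n.
--
-- In the other direction x n may tend to 0, so the gaps may be small even compared with the scale
-- of their block. Differentiability at 0 alone would not see them; continuity of the derivative
-- does.

module IntegerSolver (R : CompleteOrderedField) where
  open CompleteOrderedField R
  open Mult semiring using (×-homo-+; ×1-homo-*; 1+×) renaming (_×_ to _·_)
  open RingProperties ring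
  open AbelianGroupProperties +-abelianGroup using (⁻¹-∙-comm; ⁻¹-involutive; ε⁻¹≈ε)
  open SetoidReasoning setoid

  -- The ring solver needs coefficients whose equality is decided by computation; integers serve,
  -- mapped canonically into the field. The multiple used has `1 · 1#` equal to `1#` by computation,
  -- so that `con (+ 1)` stands for `1#` itself.
  ⟦_⟧ℤ : ℤ → Carrier
  ⟦ + n ⟧ℤ = n · 1#
  ⟦ -[1+ n ] ⟧ℤ = - (suc n · 1#)

  private
    neg-homo : ∀ i → ⟦ ℤ.- i ⟧ℤ ≈ - ⟦ i ⟧ℤ
    neg-homo (+ zero) = sym ε⁻¹≈ε
    neg-homo (+ suc n) = refl
    neg-homo -[1+ n ] = sym (⁻¹-involutive _)

    ⊖-homo : ∀ m n → ⟦ m ℤ.⊖ n ⟧ℤ ≈ m · 1# - n · 1#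
    ⊖-homo zero zero = sym (-‿inverseʳ 0#)
    ⊖-homo (suc m) zero = sym (trans (+-congˡ ε⁻¹≈ε) (+-identityʳ _))
    ⊖-homo zero (suc n) = sym (+-identityˡ _)
    ⊖-homo (suc m) (suc n) = begin
      ⟦ suc m ℤ.⊖ suc n ⟧ℤ                 ≡⟨ ≡.cong ⟦_⟧ℤ (ℤ.[1+m]⊖[1+n]≡m⊖n m n) ⟩
      ⟦ m ℤ.⊖ n ⟧ℤ                         ≈⟨ ⊖-homo m n ⟩
      m · 1# - n · 1#                      ≈⟨ +-congˡ (sym (+-identityˡ _)) ⟩
      m · 1# + (0# - n · 1#)               ≈⟨ +-congˡ (+-congʳ (sym (-‿inverseʳ 1#))) ⟩
      m · 1# + ((1# - 1#) - n · 1#)        ≈⟨ +-congˡ (+-assoc _ _ _) ⟩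
      m · 1# + (1# + (- 1# - n · 1#))      ≈⟨ +-assoc _ _ _ ⟨
      (m · 1# + 1#) + (- 1# - n · 1#)      ≈⟨ +-cong (trans (+-comm _ _) (sym (1+× m 1#))) (⁻¹-∙-comm _ _) ⟩
      suc m · 1# - (1# + n · 1#)           ≈⟨ +-congˡ (-‿cong (sym (1+× n 1#))) ⟩
      suc m · 1# - suc n · 1#              ∎

    add-homo : ∀ i j → ⟦ i ℤ.+ j ⟧ℤ ≈ ⟦ i ⟧ℤ + ⟦ j ⟧ℤ
    add-homo (+ m) (+ n) = ×-homo-+ 1# m n
    add-homo (+ m) -[1+ n ] = ⊖-homo m (suc n)
    add-homo -[1+ m ] (+ n) = trans (⊖-homo n (suc m)) (+-comm _ _)
    add-homo -[1+ m ] -[1+ n ] = begin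
      - (suc (suc (m ℕ.+ n)) · 1#)          ≡⟨ ≡.cong (λ k → - (suc k · 1#)) (≡.sym (ℕ.+-suc m n)) ⟩
      - ((suc m ℕ.+ suc n) · 1#)            ≈⟨ -‿cong (×-homo-+ 1# (suc m) (suc n)) ⟩
      - (suc m · 1# + suc n · 1#)           ≈⟨ ⁻¹-∙-comm _ _ ⟨
      - (suc m · 1#) - suc n · 1#           ∎

    nat-mul-homo : ∀ m j → ⟦ + m ℤ.* j ⟧ℤ ≈ m · 1# * ⟦ j ⟧ℤ
    nat-mul-homo m (+ n) = trans (reflexive (≡.cong ⟦_⟧ℤ (≡.sym (ℤ.pos-* m n)))) (×1-homo-* m n)
    nat-mul-homo m -[1+ n ] = begin
      ⟦ + m ℤ.* (ℤ.- (+ suc n)) ⟧ℤ          ≡⟨ ≡.cong ⟦_⟧ℤ (≡.sym (ℤ.neg-distribʳ-* (+ m) (+ suc n))) ⟩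
      ⟦ ℤ.- (+ m ℤ.* + suc n) ⟧ℤ            ≈⟨ neg-homo (+ m ℤ.* + suc n) ⟩
      - ⟦ + m ℤ.* + suc n ⟧ℤ                ≈⟨ -‿cong (nat-mul-homo m (+ suc n)) ⟩
      - (m · 1# * suc n · 1#)               ≈⟨ -‿distribʳ-* _ _ ⟩
      m · 1# * - (suc n · 1#)               ∎

    mul-homo : ∀ i j → ⟦ i ℤ.* j ⟧ℤ ≈ ⟦ i ⟧ℤ * ⟦ j ⟧ℤ
    mul-homo (+ m) j = nat-mul-homo m j
    mul-homo -[1+ m ] j = begin
      ⟦ (ℤ.- (+ suc m)) ℤ.* j ⟧ℤ            ≡⟨ ≡.cong ⟦_⟧ℤ (≡.sym (ℤ.neg-distribˡ-* (+ suc m) j)) ⟩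
      ⟦ ℤ.- (+ suc m ℤ.* j) ⟧ℤ              ≈⟨ neg-homo (+ suc m ℤ.* j) ⟩
      - ⟦ + suc m ℤ.* j ⟧ℤ                  ≈⟨ -‿cong (nat-mul-homo (suc m) j) ⟩
      - (suc m · 1# * ⟦ j ⟧ℤ)               ≈⟨ -‿distribˡ-* _ _ ⟩
      - (suc m · 1#) * ⟦ j ⟧ℤ               ∎

    morphism : ℤ.+-*-rawRing -Raw-AlmostCommutative⟶ fromCommutativeRing commutativeRing
    morphism = record
      { ⟦_⟧    = ⟦_⟧ℤ
      ; +-homo = add-homo
      ; *-homo = mul-homo
      ; -‿homo = neg-homo
      ; 0-homo = refl
      ; 1-homo = refl
      }

    ℤ-weakly-decidable : ∀ i j → Maybe (⟦ i ⟧ℤ ≈ ⟦ j ⟧ℤ)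
    ℤ-weakly-decidable i j with i ℤ.≟ j
    ... | yes ≡.refl = just refl
    ... | no _ = nothing

  open RingSolver ℤ.+-*-rawRing (fromCommutativeRing commutativeRing) morphism ℤ-weakly-decidable
    public using (solve; _:=_; _:+_; _:*_; _:-_; :-_; con)


-- Ordered field arithmetic and absolute values

module OrderedField (em : ∀ {ℓ} → ExcludedMiddle ℓ) (R : CompleteOrderedField) where
  open CompleteOrderedField R public
  open IntegerSolver R public
  open AbelianGroupProperties +-abelianGroup public using () renaming (⁻¹-involutive to -‿involutive)
  open TotalOrder totalOrder public
    using (antisym; total; ≤-respˡ-≈; ≤-respʳ-≈)
    renaming (refl to ≤-refl; reflexive to ≤-reflexive; trans to ≤-trans)
  open TotalOrderProperties totalOrder public
    using (<-respˡ-≈; <-respʳ-≈; <-trans; <⇒≱; ≰⇒>)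
  open SetoidReasoning setoid
  open Maximum totalOrder using (⊔-sel; x≤x⊔y; x≤y⊔x; ⊔-lub; ⊔-cong)

  <⇒≤ : ∀ {x y} → x < y → x ≤ y
  <⇒≤ = proj₁

  ≤-<-trans : ∀ {x y z} → x ≤ y → y < z → x < z
  ≤-<-trans x≤y (y≤z , y≉z) =
    ≤-trans x≤y y≤z , λ x≈z → y≉z (antisym y≤z (≤-respˡ-≈ x≈z x≤y))

  <-≤-trans : ∀ {x y z} → x < y → y ≤ z → x < z
  <-≤-trans (x≤y , x≉y) y≤z =
    ≤-trans x≤y y≤z , λ x≈z → x≉y (antisym x≤y (≤-respʳ-≈ (sym x≈z) y≤z))

  ≤⊎> : ∀ x y → x ≤ y ⊎ y < x
  ≤⊎> x y with em {P = x ≤ y}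
  ... | yes x≤y = inj₁ x≤y
  ... | no x≰y = inj₂ (≰⇒> x≰y)

  ≤⇒≈⊎< : ∀ {x y} → x ≤ y → x ≈ y ⊎ x < y
  ≤⇒≈⊎< {x} {y} x≤y with em {P = x ≈ y}
  ... | yes x≈y = inj₁ x≈y
  ... | no x≉y = inj₂ (x≤y , x≉y)

  x≤y⇒0≤y-x : ∀ {x y} → x ≤ y → 0# ≤ y - x
  x≤y⇒0≤y-x {x} x≤y = ≤-respˡ-≈ (-‿inverseʳ x) (+-monoˡ-≤ (- x) x≤y)

  y-x≈0⇒x≈y : ∀ {x y} → y - x ≈ 0# → x ≈ y
  y-x≈0⇒x≈y {x} {y} eq = begin
    x             ≈⟨ +-identityˡ x ⟨
    0# + x        ≈⟨ +-congʳ eq ⟨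
    (y - x) + x   ≈⟨ solve 2 (λ x y → (y :- x) :+ x := y) refl x y ⟩
    y             ∎

  x<y⇒0<y-x : ∀ {x y} → x < y → 0# < y - x
  x<y⇒0<y-x (x≤y , x≉y) = x≤y⇒0≤y-x x≤y , λ eq → x≉y (y-x≈0⇒x≈y (sym eq))

  0≤y-x⇒x≤y : ∀ {x y} → 0# ≤ y - x → x ≤ y
  0≤y-x⇒x≤y {x} {y} le =
    ≤-respʳ-≈ (solve 2 (λ x y → (y :- x) :+ x := y) refl x y)
      (≤-respˡ-≈ (+-identityˡ x) (+-monoˡ-≤ x le))

  ≤-byDifference : ∀ {x y d} → 0# ≤ d → y - x ≈ d → x ≤ y
  ≤-byDifference 0≤d eq = 0≤y-x⇒x≤y (≤-respʳ-≈ (sym eq) 0≤d)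

  <-byDifference : ∀ {x y d} → 0# < d → y - x ≈ d → x < y
  <-byDifference {x} (0≤d , 0≉d) eq =
    ≤-byDifference 0≤d eq ,
    λ x≈y → 0≉d (trans (sym (-‿inverseʳ x)) (trans (+-congʳ x≈y) eq))

  0≤+ : ∀ {x y} → 0# ≤ x → 0# ≤ y → 0# ≤ x + y
  0≤+ {x} {y} 0≤x 0≤y =
    ≤-trans 0≤x (≤-byDifference 0≤y (solve 2 (λ x y → (x :+ y) :- x := y) refl x y))

  0<+ : ∀ {x y} → 0# < x → 0# ≤ y → 0# < x + y
  0<+ {x} {y} 0<x 0≤y =
    <-≤-trans 0<x (≤-byDifference 0≤y (solve 2 (λ x y → (x :+ y) :- x := y) refl x y))

  +-mono-≤ : ∀ {a b c d} → a ≤ b → c ≤ d → a + c ≤ b + d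
  +-mono-≤ {a} {b} {c} {d} a≤b c≤d = ≤-byDifference (0≤+ (x≤y⇒0≤y-x a≤b) (x≤y⇒0≤y-x c≤d))
    (solve 4 (λ a b c d → (b :+ d) :- (a :+ c) := (b :- a) :+ (d :- c)) refl a b c d)

  +-mono-<-≤ : ∀ {a b c d} → a < b → c ≤ d → a + c < b + d
  +-mono-<-≤ {a} {b} {c} {d} a<b c≤d = <-byDifference (0<+ (x<y⇒0<y-x a<b) (x≤y⇒0≤y-x c≤d))
    (solve 4 (λ a b c d → (b :+ d) :- (a :+ c) := (b :- a) :+ (d :- c)) refl a b c d)

  neg-mono-≤ : ∀ {x y} → x ≤ y → - y ≤ - x
  neg-mono-≤ {x} {y} x≤y =
    ≤-byDifference (x≤y⇒0≤y-x x≤y) (solve 2 (λ x y → :- x :- :- y := y :- x) refl x y)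

  *-monoˡ-≤ : ∀ {x y z} → 0# ≤ z → x ≤ y → z * x ≤ z * y
  *-monoˡ-≤ {x} {y} {z} 0≤z x≤y = ≤-byDifference (*-nonNeg 0≤z (x≤y⇒0≤y-x x≤y))
    (solve 3 (λ x y z → z :* y :- z :* x := z :* (y :- x)) refl x y z)

  *-mono-≤ : ∀ {a b c d} → 0# ≤ a → 0# ≤ d → a ≤ b → c ≤ d → a * c ≤ b * d
  *-mono-≤ {a} {b} {c} {d} 0≤a 0≤d a≤b c≤d =
    ≤-trans (*-monoˡ-≤ 0≤a c≤d)
      (≤-respˡ-≈ (*-comm d a) (≤-respʳ-≈ (*-comm d b) (*-monoˡ-≤ 0≤d a≤b)))

  0≤1 : 0# ≤ 1#
  0≤1 with total 0# 1#
  ... | inj₁ 0≤1 = 0≤1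
  ... | inj₂ 1≤0 = ≤-respʳ-≈ (solve 0 ((con (+ 0) :- con (+ 1)) :* (con (+ 0) :- con (+ 1)) := con (+ 1)) refl)
                     (*-nonNeg (x≤y⇒0≤y-x 1≤0) (x≤y⇒0≤y-x 1≤0))

  0<1 : 0# < 1#
  0<1 = 0≤1 , 0≉1

  0<⇒≉0 : ∀ {x} → 0# < x → ¬ x ≈ 0#
  0<⇒≉0 (_ , 0≉x) x≈0 = 0≉x (sym x≈0)

  *-inverseˡ : ∀ x → ¬ x ≈ 0# → x ⁻¹ * x ≈ 1#
  *-inverseˡ x x≉0 = trans (*-comm _ _) (*-inverseʳ x x≉0)

  *-cancelˡ : ∀ {x y z} → ¬ x ≈ 0# → x * y ≈ x * z → y ≈ z
  *-cancelˡ {x} {y} {z} x≉0 eq = begin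
    y                 ≈⟨ *-identityˡ y ⟨
    1# * y            ≈⟨ *-congʳ (*-inverseˡ x x≉0) ⟨
    (x ⁻¹ * x) * y    ≈⟨ *-assoc _ _ _ ⟩
    x ⁻¹ * (x * y)    ≈⟨ *-congˡ eq ⟩
    x ⁻¹ * (x * z)    ≈⟨ *-assoc _ _ _ ⟨
    (x ⁻¹ * x) * z    ≈⟨ *-congʳ (*-inverseˡ x x≉0) ⟩
    1# * z            ≈⟨ *-identityˡ z ⟩
    z                 ∎

  0<* : ∀ {x y} → 0# < x → 0# < y → 0# < x * y
  0<* {x} {y} 0<x (0≤y , 0≉y) = *-nonNeg (<⇒≤ 0<x) 0≤y ,
    λ eq → 0≉y (*-cancelˡ (0<⇒≉0 0<x) (trans (zeroʳ x) eq))

  *-cancelˡ-≤ : ∀ {x y z} → 0# < x → x * y ≤ x * z → y ≤ z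
  *-cancelˡ-≤ {x} {y} {z} 0<x le with ≤⊎> y z
  ... | inj₁ y≤z = y≤z
  ... | inj₂ z<y = ⊥-elim (<⇒≱ (<-byDifference (0<* 0<x (x<y⇒0<y-x z<y))
    (solve 3 (λ x y z → x :* y :- x :* z := x :* (y :- z)) refl x y z)) le)

  *-cancelˡ-< : ∀ {x y z} → 0# < x → x * y < x * z → y < z
  *-cancelˡ-< 0<x (le , ne) = *-cancelˡ-≤ 0<x le , λ eq → ne (*-congˡ eq)

  *-monoˡ-< : ∀ {x y z} → 0# < z → x < y → z * x < z * y
  *-monoˡ-< {x} {y} {z} 0<z x<y = <-byDifference (0<* 0<z (x<y⇒0<y-x x<y))
    (solve 3 (λ x y z → z :* y :- z :* x := z :* (y :- x)) refl x y z)

  0<⁻¹ : ∀ {x} → 0# < x → 0# < x ⁻¹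
  0<⁻¹ {x} 0<x = *-cancelˡ-< 0<x
    (<-respˡ-≈ (sym (zeroʳ x)) (<-respʳ-≈ (sym (*-inverseʳ x (0<⇒≉0 0<x))) 0<1))

  1+1>0 : 0# < 1# + 1#
  1+1>0 = 0<+ 0<1 0≤1

  ½ : Carrier
  ½ = (1# + 1#) ⁻¹

  0<½ : 0# < ½
  0<½ = 0<⁻¹ 1+1>0

  ½+½≈1 : ½ + ½ ≈ 1#
  ½+½≈1 = trans (solve 1 (λ h → h :+ h := (con (+ 1) :+ con (+ 1)) :* h) refl ½)
                (*-inverseʳ _ (0<⇒≉0 1+1>0))

  ½*+½* : ∀ x → ½ * x + ½ * x ≈ x
  ½*+½* x = trans (sym (distribʳ x ½ ½)) (trans (*-congʳ ½+½≈1) (*-identityˡ x))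

  ½*< : ∀ {x} → 0# < x → ½ * x < x
  ½*< {x} 0<x = <-byDifference (0<* 0<½ 0<x)
    (trans (+-congʳ (sym (½*+½* x))) (solve 1 (λ y → (y :+ y) :- y := y) refl (½ * x)))

  -- Brings a hypothesis `l ≈ r` into reach of the ring solver: `y - x` is exhibited as a multiple
  -- of `r - l`, and what remains is a polynomial identity. The hypothesis is mostly
  -- `z * z ⁻¹ ≈ 1#`.
  ≈-byMultiple : ∀ {x y l r} c → l ≈ r → y - x ≈ c * (r - l) → x ≈ y
  ≈-byMultiple {l = l} c l≈r eq = y-x≈0⇒x≈y (trans eq
    (trans (*-congˡ (trans (+-congʳ (sym l≈r)) (-‿inverseʳ l))) (zeroʳ c)))

  x≤∣x∣ : ∀ x → x ≤ ∣ x ∣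
  x≤∣x∣ x = x≤x⊔y x (- x)

  -x≤∣x∣ : ∀ x → - x ≤ ∣ x ∣
  -x≤∣x∣ x = x≤y⊔x x (- x)

  ∣∣-≤ : ∀ {x c} → x ≤ c → - x ≤ c → ∣ x ∣ ≤ c
  ∣∣-≤ = ⊔-lub

  ∣∣-< : ∀ {x c} → x < c → - x < c → ∣ x ∣ < c
  ∣∣-< {x} x<c -x<c with ⊔-sel x (- x)
  ... | inj₁ eq = <-respˡ-≈ (sym eq) x<c
  ... | inj₂ eq = <-respˡ-≈ (sym eq) -x<c

  ∣∣-cong : ∀ {x y} → x ≈ y → ∣ x ∣ ≈ ∣ y ∣
  ∣∣-cong x≈y = ⊔-cong x≈y (-‿cong x≈y)

  ∣-∣ : ∀ x → ∣ - x ∣ ≈ ∣ x ∣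
  ∣-∣ x = antisym (∣∣-≤ (-x≤∣x∣ x) (≤-respˡ-≈ (sym (-‿involutive x)) (x≤∣x∣ x)))
                  (∣∣-≤ (≤-respˡ-≈ (-‿involutive x) (-x≤∣x∣ (- x))) (x≤∣x∣ (- x)))

  ∣x-y∣≈∣y-x∣ : ∀ x y → ∣ x - y ∣ ≈ ∣ y - x ∣
  ∣x-y∣≈∣y-x∣ x y = trans (∣∣-cong (solve 2 (λ x y → x :- y := :- (y :- x)) refl x y)) (∣-∣ _)

  0≤∣∣ : ∀ x → 0# ≤ ∣ x ∣
  0≤∣∣ x with total 0# x
  ... | inj₁ 0≤x = ≤-trans 0≤x (x≤∣x∣ x)
  ... | inj₂ x≤0 = ≤-trans (≤-respʳ-≈ (solve 1 (λ x → con (+ 0) :- x := :- x) refl x) (x≤y⇒0≤y-x x≤0)) (-x≤∣x∣ x)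

  0≤x⇒∣x∣≈x : ∀ {x} → 0# ≤ x → ∣ x ∣ ≈ x
  0≤x⇒∣x∣≈x {x} 0≤x = antisym (∣∣-≤ ≤-refl (≤-trans
    (≤-byDifference 0≤x (solve 1 (λ x → con (+ 0) :- :- x := x) refl x)) 0≤x)) (x≤∣x∣ x)

  ∣x+y∣≤∣x∣+∣y∣ : ∀ x y → ∣ x + y ∣ ≤ ∣ x ∣ + ∣ y ∣
  ∣x+y∣≤∣x∣+∣y∣ x y = ∣∣-≤ (+-mono-≤ (x≤∣x∣ x) (x≤∣x∣ y))
    (≤-respˡ-≈ (solve 2 (λ x y → :- x :- y := :- (x :+ y)) refl x y) (+-mono-≤ (-x≤∣x∣ x) (-x≤∣x∣ y)))

  ∣x*y∣≈x*∣y∣ : ∀ {x} y → 0# ≤ x → ∣ x * y ∣ ≈ x * ∣ y ∣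
  ∣x*y∣≈x*∣y∣ {x} y 0≤x = antisym
    (∣∣-≤ (*-monoˡ-≤ 0≤x (x≤∣x∣ y))
          (≤-respˡ-≈ (solve 2 (λ x y → x :* :- y := :- (x :* y)) refl x y) (*-monoˡ-≤ 0≤x (-x≤∣x∣ y))))
    (helper (⊔-sel y (- y)))
    where
    helper : ∣ y ∣ ≈ y ⊎ ∣ y ∣ ≈ - y → x * ∣ y ∣ ≤ ∣ x * y ∣
    helper (inj₁ eq) = ≤-respˡ-≈ (*-congˡ (sym eq)) (x≤∣x∣ _)
    helper (inj₂ eq) = ≤-respˡ-≈
      (trans (solve 2 (λ x y → :- (x :* y) := x :* :- y) refl x y) (*-congˡ (sym eq))) (-x≤∣x∣ _)

  ∣x*y∣≈∣x∣*∣y∣ : ∀ x y → ∣ x * y ∣ ≈ ∣ x ∣ * ∣ y ∣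
  ∣x*y∣≈∣x∣*∣y∣ x y with ⊔-sel x (- x)
  ... | inj₁ eq = trans (∣x*y∣≈x*∣y∣ y (≤-respʳ-≈ eq (0≤∣∣ x))) (*-congʳ (sym eq))
  ... | inj₂ eq = begin
    ∣ x * y ∣        ≈⟨ ∣-∣ (x * y) ⟨
    ∣ - (x * y) ∣    ≈⟨ ∣∣-cong (solve 2 (λ x y → :- (x :* y) := (:- x) :* y) refl x y) ⟩
    ∣ (- x) * y ∣    ≈⟨ ∣x*y∣≈x*∣y∣ y (≤-respʳ-≈ eq (0≤∣∣ x)) ⟩
    (- x) * ∣ y ∣    ≈⟨ *-congʳ eq ⟨
    ∣ x ∣ * ∣ y ∣    ∎

  ∣y-x∣<d⇒y<x+d : ∀ {x y d} → ∣ y - x ∣ < d → y < x + d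
  ∣y-x∣<d⇒y<x+d {x} {y} {d} lt = <-byDifference (x<y⇒0<y-x (≤-<-trans (x≤∣x∣ _) lt))
    (solve 3 (λ x y d → (x :+ d) :- y := d :- (y :- x)) refl x y d)

  ∣y-x∣<d⇒x-d<y : ∀ {x y d} → ∣ y - x ∣ < d → x - d < y
  ∣y-x∣<d⇒x-d<y {x} {y} {d} lt = <-byDifference (x<y⇒0<y-x (≤-<-trans (-x≤∣x∣ _) lt))
    (solve 3 (λ x y d → y :- (x :- d) := d :- :- (y :- x)) refl x y d)

  ∣y-x∣<d : ∀ {x y d} → y < x + d → x - d < y → ∣ y - x ∣ < d
  ∣y-x∣<d {x} {y} {d} lt lt′ = ∣∣-<
    (<-byDifference (x<y⇒0<y-x lt) (solve 3 (λ x y d → d :- (y :- x) := (x :+ d) :- y) refl x y d))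
    (<-byDifference (x<y⇒0<y-x lt′) (solve 3 (λ x y d → d :- :- (y :- x) := y :- (x :- d)) refl x y d))

  min : ∀ {a b} → 0# < a → 0# < b → Σ[ c ∈ Carrier ] 0# < c × c ≤ a × c ≤ b
  min {a} {b} 0<a 0<b with total a b
  ... | inj₁ a≤b = a , 0<a , ≤-refl , a≤b
  ... | inj₂ b≤a = b , 0<b , b≤a , ≤-refl

  ≤0-if-<-all : ∀ {x} → (∀ ε → 0# < ε → x < ε) → x ≤ 0#
  ≤0-if-<-all {x} small with ≤⊎> x 0#
  ... | inj₁ x≤0 = x≤0
  ... | inj₂ 0<x = ⊥-elim (<⇒≱ (small x 0<x) ≤-refl)

  ∣x-y∣≤0⇒x≈y : ∀ {x y} → ∣ x - y ∣ ≤ 0# → x ≈ y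
  ∣x-y∣≤0⇒x≈y {x} {y} le = antisym
    (0≤y-x⇒x≤y (≤-byDifference (x≤y⇒0≤y-x (≤-trans (x≤∣x∣ _) le))
       (solve 2 (λ x y → (y :- x) :- con (+ 0) := con (+ 0) :- (x :- y)) refl x y)))
    (0≤y-x⇒x≤y (≤-byDifference (x≤y⇒0≤y-x (≤-trans (-x≤∣x∣ _) le))
       (solve 2 (λ x y → (x :- y) :- con (+ 0) := con (+ 0) :- :- (x :- y)) refl x y)))

-- Estimates, node sequences and transitions between them

module Interpolation (em : ∀ {ℓ} → ExcludedMiddle ℓ) (R : CompleteOrderedField) where
  open OrderedField em R
  open Reals R
  open SetoidReasoning setoid

  -- From a b - a₀ b₀ = (a - a₀) b + a₀ (b - b₀), where η ≤ 1 keeps ∣b∣ below 1 + ∣b₀∣. The summand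
  -- 1 in `M` makes it positive and makes the first term strictly smaller than its bound.
  product-estimate : ∀ a₀ b₀ ε → 0# < ε → Σ[ η ∈ Carrier ] 0# < η ×
    (∀ a b → ∣ a - a₀ ∣ < η → ∣ b - b₀ ∣ < η → ∣ a * b - a₀ * b₀ ∣ < ε)
  product-estimate a₀ b₀ ε 0<ε = η , 0<η , estimate
    where
    M = 1# + (∣ a₀ ∣ + ∣ b₀ ∣)
    0<M : 0# < M
    0<M = 0<+ 0<1 (0≤+ (0≤∣∣ a₀) (0≤∣∣ b₀))
    bound = min 0<1 (0<* 0<ε (0<⁻¹ 0<M))
    η = proj₁ bound
    0<η = proj₁ (proj₂ bound)
    η≤1 = proj₁ (proj₂ (proj₂ bound))
    η≤ε/M = proj₂ (proj₂ (proj₂ bound))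
    estimate : ∀ a b → ∣ a - a₀ ∣ < η → ∣ b - b₀ ∣ < η → ∣ a * b - a₀ * b₀ ∣ < ε
    estimate a b a~ b~ = <-≤-trans (≤-<-trans
      (≤-respˡ-≈ (∣∣-cong (solve 4 (λ a b a₀ b₀ →
          (a :- a₀) :* b :+ a₀ :* (b :- b₀) := a :* b :- a₀ :* b₀) refl a b a₀ b₀))
        (≤-trans (∣x+y∣≤∣x∣+∣y∣ _ _) (+-mono-≤ (≤-reflexive (∣x*y∣≈∣x∣*∣y∣ _ _)) (≤-reflexive (∣x*y∣≈∣x∣*∣y∣ _ _)))))
      step) (≤-trans (*-monoˡ-≤ (<⇒≤ 0<M) η≤ε/M) (≤-reflexive M*ε/M))
      where
      ∣b∣≤ : ∣ b ∣ ≤ 1# + ∣ b₀ ∣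
      ∣b∣≤ = ≤-trans (≤-respˡ-≈ (∣∣-cong (solve 2 (λ b b₀ → (b :- b₀) :+ b₀ := b) refl b b₀))
               (∣x+y∣≤∣x∣+∣y∣ _ _)) (+-mono-≤ (≤-trans (<⇒≤ b~) η≤1) ≤-refl)
      step : ∣ a - a₀ ∣ * ∣ b ∣ + ∣ a₀ ∣ * ∣ b - b₀ ∣ < M * η
      step = ≤-<-trans (+-mono-≤ (*-monoˡ-≤ (0≤∣∣ _) ∣b∣≤) (*-monoˡ-≤ (0≤∣∣ _) (<⇒≤ b~)))
        (<-byDifference (0<* (0<+ 0<1 (0≤∣∣ b₀)) (x<y⇒0<y-x a~))
          (solve 4 (λ η A B D → (con (+ 1) :+ (A :+ B)) :* η :- (D :* (con (+ 1) :+ B) :+ A :* η)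
              := (con (+ 1) :+ B) :* (η :- D)) refl η (∣ a₀ ∣) (∣ b₀ ∣) (∣ a - a₀ ∣)))
      M*ε/M : M * (ε * M ⁻¹) ≈ ε
      M*ε/M = trans (solve 3 (λ M N ε → M :* (ε :* N) := (M :* N) :* ε) refl M (M ⁻¹) ε)
                (trans (*-congʳ (*-inverseʳ M (0<⇒≉0 0<M))) (*-identityˡ ε))

  small-multiples : ∀ {C ε} → 0# ≤ C → 0# < ε → Σ[ δ ∈ Carrier ] 0# < δ × (∀ z → z < δ → 0# ≤ z → C * z < ε)
  small-multiples {C} {ε} 0≤C 0<ε = ε * M ⁻¹ , 0<* 0<ε (0<⁻¹ 0<M) , λ z z< 0≤z →
    ≤-<-trans (≤-byDifference 0≤z (solve 2 (λ C z → (con (+ 1) :+ C) :* z :- C :* z := z) refl C z))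
      (<-respʳ-≈ (trans (solve 3 (λ M N ε → M :* (ε :* N) := (M :* N) :* ε) refl M (M ⁻¹) ε)
                (trans (*-congʳ (*-inverseʳ M (0<⇒≉0 0<M))) (*-identityˡ ε)))
        (*-monoˡ-< 0<M z<))
    where
    -- The summand 1 allows the division when `C` is 0.
    M = 1# + C
    0<M : 0# < M
    0<M = 0<+ 0<1 0≤C

  Point : Set
  Point = Space.Carrier [0,1]

  *-continuous : ∀ {f g} → Continuous f → Continuous g → Continuous (λ x → f x * g x)
  *-continuous {f} {g} f-cont g-cont x ε 0<ε =
    let η , 0<η , estimate = product-estimate (f x) (g x) ε 0<ε
        δ₁ , 0<δ₁ , near₁ = f-cont x η 0<η
        δ₂ , 0<δ₂ , near₂ = g-cont x η 0<η
        δ , 0<δ , δ≤δ₁ , δ≤δ₂ = min 0<δ₁ 0<δ₂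
    in δ , 0<δ , λ y y~ →
         estimate (f y) (g y) (near₁ y (<-≤-trans y~ δ≤δ₁)) (near₂ y (<-≤-trans y~ δ≤δ₂))

  x≈y⇒∣x-y∣≈0 : ∀ {x y} → x ≈ y → ∣ x - y ∣ ≈ 0#
  x≈y⇒∣x-y∣≈0 {x} {y} x≈y = trans (∣∣-cong (trans (+-congʳ x≈y) (-‿inverseʳ y))) (0≤x⇒∣x∣≈x ≤-refl)

  x≉y⇒x-y≉0 : ∀ {x y} → ¬ x ≈ y → ¬ x - y ≈ 0#
  x≉y⇒x-y≉0 x≉y eq = x≉y (sym (y-x≈0⇒x≈y eq))

  0<∣x∣ : ∀ {x} → ¬ x ≈ 0# → 0# < ∣ x ∣
  0<∣x∣ {x} x≉0 = 0≤∣∣ x , λ eq → x≉0 (antisym (≤-respʳ-≈ (sym eq) (x≤∣x∣ x))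
    (≤-byDifference (x≤y⇒0≤y-x (≤-respʳ-≈ (sym eq) (-x≤∣x∣ x)))
      (solve 1 (λ x → x :- con (+ 0) := con (+ 0) :- :- x) refl x)))

  quotient-estimate : ∀ {a z d ε} → ¬ z ≈ 0# → ∣ a - d * z ∣ ≤ ε * ∣ z ∣ → ∣ a * z ⁻¹ - d ∣ ≤ ε
  quotient-estimate {a} {z} {d} {ε} z≉0 le = *-cancelˡ-≤ (0<∣x∣ z≉0)
    (≤-respˡ-≈ (trans (∣∣-cong eq) (∣x*y∣≈∣x∣*∣y∣ z _)) (≤-respʳ-≈ (*-comm ε _) le))
    where
    eq : a - d * z ≈ z * (a * z ⁻¹ - d)
    eq = ≈-byMultiple a (sym (*-inverseʳ z z≉0))
      (solve 4 (λ a z v d → (z :* (a :* v :- d)) :- (a :- d :* z) := a :* (z :* v :- con (+ 1))) refl a z (z ⁻¹) d)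

  differentiable⇒continuous : ∀ {f f′ : Point → Carrier} → (∀ (x y : Point) → proj₁ x ≈ proj₁ y → f x ≈ f y) →
    (∀ x → HasDerivativeAt f x (f′ x)) → Continuous f
  differentiable⇒continuous {f} {f′} f-cong deriv x ε 0<ε =
    let δ₁ , 0<δ₁ , near = deriv x 1# 0<1
        δ₂ , 0<δ₂ , small = small-multiples (0≤+ 0≤1 (0≤∣∣ (f′ x))) 0<ε
        δ , 0<δ , δ≤δ₁ , δ≤δ₂ = min 0<δ₁ 0<δ₂
    in δ , 0<δ , λ y y~ → conclude δ₁ y (near y) (<-≤-trans y~ δ≤δ₁)
                            (small _ (<-≤-trans y~ δ≤δ₂) (0≤∣∣ _))
    where
    conclude : ∀ δ₁ (y : Point) → let z = proj₁ y - proj₁ x in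
      (¬ proj₁ y ≈ proj₁ x → ∣ z ∣ < δ₁ → ∣ (f y - f x) * z ⁻¹ - f′ x ∣ < 1#) →
      ∣ z ∣ < δ₁ → (1# + ∣ f′ x ∣) * ∣ z ∣ < ε → ∣ f y - f x ∣ < ε
    conclude δ₁ y near z~ small with em {P = proj₁ y ≈ proj₁ x}
    -- The derivative says nothing about points equal to `x`; there congruence of `f` is used.
    ... | yes y≈x = <-respˡ-≈ (sym (x≈y⇒∣x-y∣≈0 (f-cong y x y≈x))) 0<ε
    ... | no y≉x = ≤-<-trans (≤-respˡ-≈ (sym quotient*z) (≤-respˡ-≈ (*-comm _ _)
        (≤-respʳ-≈ (*-comm _ _) (*-monoˡ-≤ (0≤∣∣ z) ∣quotient∣≤)))) small
      where
      z = proj₁ y - proj₁ x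
      quotient = (f y - f x) * z ⁻¹
      ∣quotient∣≤ : ∣ quotient ∣ ≤ 1# + ∣ f′ x ∣
      ∣quotient∣≤ = ≤-trans (≤-respˡ-≈ (∣∣-cong (solve 2 (λ a d → (a :- d) :+ d := a) refl quotient (f′ x)))
        (∣x+y∣≤∣x∣+∣y∣ _ _)) (+-mono-≤ (<⇒≤ (near y≉x z~)) ≤-refl)
      quotient*z : ∣ f y - f x ∣ ≈ ∣ quotient ∣ * ∣ z ∣
      quotient*z = trans (∣∣-cong (≈-byMultiple (f y - f x) (sym (*-inverseʳ z (x≉y⇒x-y≉0 y≉x)))
        (solve 3 (λ a z v → (a :* v) :* z :- a := a :* (z :* v :- con (+ 1))) refl (f y - f x) z (z ⁻¹))))
        (∣x*y∣≈∣x∣*∣y∣ _ _)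

  within⇒above : ∀ {δ t t′ a} → δ ≤ t - a → ∣ t′ - t ∣ < δ → a < t′
  within⇒above {δ} {t} {t′} {a} δ≤ t′~ = ≤-<-trans
    (≤-byDifference (x≤y⇒0≤y-x δ≤) (solve 3 (λ t a δ → (t :- δ) :- a := (t :- a) :- δ) refl t a δ))
    (∣y-x∣<d⇒x-d<y t′~)

  within⇒below : ∀ {δ t t′ a} → δ ≤ a - t → ∣ t′ - t ∣ < δ → t′ < a
  within⇒below {δ} {t} {t′} {a} δ≤ t′~ = <-≤-trans (∣y-x∣<d⇒y<x+d t′~)
    (≤-byDifference (x≤y⇒0≤y-x δ≤) (solve 3 (λ t a δ → a :- (t :+ δ) := (a :- t) :- δ) refl t a δ))

  y≈0⇒∣x-y∣≈x : ∀ {x y} → y ≈ 0# → 0# ≤ x → ∣ x - y ∣ ≈ x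
  y≈0⇒∣x-y∣≈x {x} {y} y≈0 0≤x = trans (∣∣-cong (trans (+-congˡ (-‿cong y≈0))
    (solve 1 (λ x → x :- con (+ 0) := x) refl x))) (0≤x⇒∣x∣≈x 0≤x)

  -- The slope of a chord is within ε of 1, for t′ ≤ t and written without division. In this form it
  -- also covers t = t′ and is additive over adjacent intervals, which serves both the sums over
  -- nodes and the mean value inequality.
  AlmostIsometric : Carrier → Carrier → Carrier → Carrier → Carrier → Set
  AlmostIsometric ε t s t′ s′ = ∣ (s - s′) - (t - t′) ∣ ≤ ε * (t - t′)

  almost-trans : ∀ {ε t s t′ s′ t″ s″} →
    AlmostIsometric ε t s t′ s′ → AlmostIsometric ε t′ s′ t″ s″ → AlmostIsometric ε t s t″ s″
  almost-trans {ε} {t} {s} {t′} {s′} {t″} {s″} le le′ =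
    ≤-respˡ-≈ (∣∣-cong (solve 6 (λ t s t′ s′ t″ s″ →
        ((s :- s′) :- (t :- t′)) :+ ((s′ :- s″) :- (t′ :- t″)) := (s :- s″) :- (t :- t″)) refl t s t′ s′ t″ s″))
      (≤-respʳ-≈ (solve 4 (λ ε t t′ t″ → ε :* (t :- t′) :+ ε :* (t′ :- t″) := ε :* (t :- t″)) refl ε t t′ t″)
        (≤-trans (∣x+y∣≤∣x∣+∣y∣ _ _) (+-mono-≤ le le′)))

  almost-chord : ∀ {ε t s t′ s′ m} → t′ ≤ t → s - s′ ≈ (t - t′) * m → ∣ m - 1# ∣ ≤ ε → AlmostIsometric ε t s t′ s′
  almost-chord {ε} {t} {s} {t′} {s′} {m} t′≤t eq m~ = ≤-respʳ-≈ (*-comm _ _)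
    (≤-respˡ-≈ (sym (trans (∣∣-cong (trans (+-congʳ eq)
        (solve 2 (λ d m → d :* m :- d := d :* (m :- con (+ 1))) refl (t - t′) m)))
        (∣x*y∣≈x*∣y∣ _ (x≤y⇒0≤y-x t′≤t))))
      (*-monoˡ-≤ (x≤y⇒0≤y-x t′≤t) m~))

  record Nodes : Set where
    field
      node       : ℕ → Carrier
      node-zero  : node 0 ≈ 1#
      decreasing : ∀ k → node (suc k) < node k
      positive   : ∀ k → 0# < node k
      vanishing  : ∀ ε → 0# < ε → Σ[ k ∈ ℕ ] node k < ε

    antitone : ∀ {i j} → i ℕ.≤ j → node j ≤ node i
    antitone i≤j = go (ℕ.≤⇒≤′ i≤j)
      where
      go : ∀ {i j} → i ℕ.≤′ j → node j ≤ node i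
      go ℕ.≤′-refl = ≤-refl
      go (ℕ.≤′-step i≤j) = ≤-trans (<⇒≤ (decreasing _)) (go i≤j)

    node<⇒< : ∀ {i j} → node j < node i → i ℕ.< j
    node<⇒< {i} {j} lt with ℕ.<-cmp i j
    ... | tri< i<j _ _ = i<j
    ... | tri≈ _ ≡.refl _ = ⊥-elim (<⇒≱ lt ≤-refl)
    ... | tri> _ _ j<i = ⊥-elim (<⇒≱ lt (antitone (ℕ.<⇒≤ j<i)))

    locate : ∀ {t} → 0# < t → t ≤ 1# → Σ[ k ∈ ℕ ] node (suc k) < t × t ≤ node k
    locate {t} 0<t t≤1 = let k , lt = vanishing t 0<t in search k lt
      where
      search : ∀ k → node k < t → Σ[ k ∈ ℕ ] node (suc k) < t × t ≤ node k
      search zero lt = ⊥-elim (<⇒≱ (<-respˡ-≈ node-zero lt) t≤1)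
      search (suc k) lt with ≤⊎> t (node k)
      ... | inj₁ le = k , lt , le
      ... | inj₂ lt′ = search k lt′

    node-point : ℕ → Point
    node-point k = node k , <⇒≤ (positive k) , ≤-respʳ-≈ node-zero (antitone ℕ.z≤n)

  -- The common nodes in `fixed` come arbitrarily close to 0. They let the displacement of a point
  -- near 0 be estimated by a finite sum over the nodes between it and a common node, with no
  -- passage to a limit.
  record Transition (P Q : Nodes) : Set where
    private
      module P = Nodes P
      module Q = Nodes Q
    field
      weight   : ℕ → Carrier
      weight>0 : ∀ k → 0# < weight k
      steps    : ∀ k → Q.node k - Q.node (suc k) ≈
                       (P.node k - P.node (suc k)) * (weight k * weight (suc k))
      weight→1 : ∀ ε → 0# < ε → Σ[ N ∈ ℕ ] (∀ k → N ℕ.≤ k → ∣ weight k - 1# ∣ < ε)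
      fixed    : ∀ k → Σ[ i ∈ ℕ ] k ℕ.≤ i × P.node i ≈ Q.node i

  -- With η ≤ ½ the number x exceeds ½, so x ∣x⁻¹ - 1∣ = ∣x - 1∣ < ½ ε ≤ x ε.
  ∣x⁻¹-1∣-estimate : ∀ ε → 0# < ε → Σ[ η ∈ Carrier ] 0# < η ×
    (∀ x → 0# < x → ∣ x - 1# ∣ < η → ∣ x ⁻¹ - 1# ∣ < ε)
  ∣x⁻¹-1∣-estimate ε 0<ε =
    let η , 0<η , η≤½ , η≤½ε = min 0<½ (0<* 0<½ 0<ε)
    in η , 0<η , λ x 0<x x~ → *-cancelˡ-< 0<x
      (<-respˡ-≈ (trans (∣x-y∣≈∣y-x∣ x 1#) (trans (∣∣-cong (≈-byMultiple 1# (sym (*-inverseʳ x (0<⇒≉0 0<x)))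
           (solve 2 (λ x v → (x :* (v :- con (+ 1))) :- (con (+ 1) :- x)
                := con (+ 1) :* (x :* v :- con (+ 1))) refl x (x ⁻¹))))
         (∣x*y∣≈x*∣y∣ _ (<⇒≤ 0<x))))
       (<-≤-trans x~ (≤-trans η≤½ε
         (≤-respˡ-≈ (*-comm ε ½) (≤-respʳ-≈ (*-comm ε x) (*-monoˡ-≤ (<⇒≤ 0<ε)
           (≤-trans (≤-reflexive (≈-byMultiple 1# ½+½≈1
             (solve 1 (λ h → (con (+ 1) :- h) :- h := con (+ 1) :* (con (+ 1) :- (h :+ h))) refl ½)))
           (≤-trans (+-mono-≤ ≤-refl (neg-mono-≤ η≤½)) (<⇒≤ (∣y-x∣<d⇒x-d<y x~))))))))))

  ⁻¹-involutive : ∀ {x} → 0# < x → x ⁻¹ ⁻¹ ≈ x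
  ⁻¹-involutive {x} 0<x = *-cancelˡ (0<⇒≉0 (0<⁻¹ 0<x))
    (trans (*-inverseʳ _ (0<⇒≉0 (0<⁻¹ 0<x))) (sym (*-inverseˡ x (0<⇒≉0 0<x))))

  divide-product : ∀ {a b x y} → 0# < x → 0# < y → a ≈ b * (x * y) → b ≈ a * (x ⁻¹ * y ⁻¹)
  divide-product {a} {b} {x} {y} 0<x 0<y eq = begin
    b                                  ≈⟨ *-identityʳ b ⟨
    b * 1#                             ≈⟨ *-congˡ (*-identityˡ 1#) ⟨
    b * (1# * 1#)                      ≈⟨ *-congˡ (*-cong (*-inverseʳ x (0<⇒≉0 0<x)) (*-inverseʳ y (0<⇒≉0 0<y))) ⟨
    b * ((x * x ⁻¹) * (y * y ⁻¹))      ≈⟨ solve 5 (λ b x x′ y y′ → b :* ((x :* x′) :* (y :* y′)) := (b :* (x :* y)) :* (x′ :* y′)) refl b x (x ⁻¹) y (y ⁻¹) ⟩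
    (b * (x * y)) * (x ⁻¹ * y ⁻¹)      ≈⟨ *-congʳ eq ⟨
    a * (x ⁻¹ * y ⁻¹)                  ∎

  swap : ∀ {P Q} → Transition P Q → Transition Q P
  swap T = record
    { weight   = λ k → weight k ⁻¹
    ; weight>0 = λ k → 0<⁻¹ (weight>0 k)
    ; steps    = λ k → divide-product (weight>0 k) (weight>0 (suc k)) (steps k)
    ; weight→1 = λ ε 0<ε →
        let η , 0<η , estimate = ∣x⁻¹-1∣-estimate ε 0<ε
            N , near = weight→1 η 0<η
        in N , λ k N≤k → estimate (weight k) (weight>0 k) (near k N≤k)
    ; fixed    = λ k → let i , k≤i , eq = fixed k in i , k≤i , sym eq
    }
    where open Transition T

-- Möbius pieces between consecutive nodes

module Pieces (em : ∀ {ℓ} → ExcludedMiddle ℓ) (R : CompleteOrderedField)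
  (P Q : Interpolation.Nodes em R) (T : Interpolation.Transition em R P Q) where
  open OrderedField em R
  open Reals R
  open Interpolation em R
  open SetoidReasoning setoid
  private
    module P = Nodes P
    module Q = Nodes Q
  open P using () renaming (node to p)
  open Q using () renaming (node to q)
  open Transition T renaming (weight to w; weight>0 to w>0)

  -- The graph on [p (k + 1) , p k] of the Möbius map whose derivative has square
  -- roots w (k + 1) and w k at the ends; u is the square root of the derivative.
  record Piece (k : ℕ) (t s u : Carrier) : Set where
    field
      lower : p (suc k) ≤ t
      upper : t ≤ p k
      root>0 : 0# < u
      left  : s - q (suc k) ≈ (t - p (suc k)) * (u * w (suc k))
      right : q k - s ≈ (p k - t) * (u * w k)

  open Piece

  Piece-resp-≈ : ∀ {k t t′ s s′ u u′} → t ≈ t′ → s ≈ s′ → u ≈ u′ → Piece k t s u → Piece k t′ s′ u′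
  Piece-resp-≈ t≈ s≈ u≈ π = record
    { lower  = ≤-respʳ-≈ t≈ (lower π)
    ; upper  = ≤-respˡ-≈ t≈ (upper π)
    ; root>0 = <-respʳ-≈ u≈ (root>0 π)
    ; left   = trans (+-congʳ (sym s≈)) (trans (left π) (*-cong (+-congʳ t≈) (*-congʳ u≈)))
    ; right  = trans (+-congˡ (-‿cong (sym s≈))) (trans (right π) (*-cong (+-congˡ (-‿cong t≈)) (*-congʳ u≈)))
    }

  0<Δp : ∀ k → 0# < p k - p (suc k)
  0<Δp k = x<y⇒0<y-x (P.decreasing k)

  0<Δq : ∀ k → 0# < q k - q (suc k)
  0<Δq k = x<y⇒0<y-x (Q.decreasing k)

  image-lower : ∀ {k t s u} → Piece k t s u → q (suc k) ≤ s
  image-lower {k} π =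
    ≤-byDifference (*-nonNeg (x≤y⇒0≤y-x (lower π)) (<⇒≤ (0<* (root>0 π) (w>0 (suc k))))) (left π)

  image-upper : ∀ {k t s u} → Piece k t s u → s ≤ q k
  image-upper {k} π =
    ≤-byDifference (*-nonNeg (x≤y⇒0≤y-x (upper π)) (<⇒≤ (0<* (root>0 π) (w>0 k)))) (right π)

  -- Adding the equations `left` and `right` of a piece gives q k - q (k + 1) = u times this affine
  -- function of t. So it is, up to a factor, the denominator of the Möbius map, and its inverse is
  -- the square root of the derivative.
  denominator : ℕ → Carrier → Carrier
  denominator k t = (t - p (suc k)) * w (suc k) + (p k - t) * w k

  Δq≈root*denominator : ∀ {k t s u} → Piece k t s u → q k - q (suc k) ≈ u * denominator k t
  Δq≈root*denominator {k} {t} {s} {u} π = begin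
    q k - q (suc k)                   ≈⟨ solve 3 (λ q q′ s → q :- q′ := (s :- q′) :+ (q :- s)) refl (q k) (q (suc k)) s ⟩
    (s - q (suc k)) + (q k - s)       ≈⟨ +-cong (left π) (right π) ⟩
    (t - p (suc k)) * (u * w (suc k)) + (p k - t) * (u * w k)
      ≈⟨ solve 5 (λ a b u w w′ → a :* (u :* w′) :+ b :* (u :* w) := u :* (a :* w′ :+ b :* w)) refl
           (t - p (suc k)) (p k - t) u (w k) (w (suc k)) ⟩
    u * denominator k t               ∎

  0<denominator : ∀ {k t} → p (suc k) ≤ t → t ≤ p k → 0# < denominator k t
  0<denominator {k} {t} l h with ≤⊎> t (p (suc k))
  ... | inj₁ t≤p′ = <-respʳ-≈ (+-comm _ _)
    (0<+ (0<* (x<y⇒0<y-x (≤-<-trans t≤p′ (P.decreasing k))) (w>0 k))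
         (*-nonNeg (x≤y⇒0≤y-x l) (<⇒≤ (w>0 (suc k)))))
  ... | inj₂ p′<t = 0<+ (0<* (x<y⇒0<y-x p′<t) (w>0 (suc k)))
         (*-nonNeg (x≤y⇒0≤y-x h) (<⇒≤ (w>0 k)))

  Piece-total : ∀ {k t} → p (suc k) ≤ t → t ≤ p k → Σ[ s ∈ Carrier ] Σ[ u ∈ Carrier ] Piece k t s u
  Piece-total {k} {t} l h = s , u , record
    { lower  = l
    ; upper  = h
    ; root>0 = 0<* (0<Δq k) (0<⁻¹ 0<D)
    ; left   = solve 2 (λ a b → (a :+ b) :- a := b) refl (q (suc k)) _
    ; right  = ≈-byMultiple (q k - q (suc k)) (sym (*-inverseʳ D (0<⇒≉0 0<D)))
        (solve 7 (λ q q′ a b w w′ v →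
           let Δ = q :- q′ ; u = Δ :* v in
           b :* (u :* w) :- (q :- (q′ :+ a :* (u :* w′))) := Δ :* ((a :* w′ :+ b :* w) :* v :- con (+ 1)))
           refl (q k) (q (suc k)) (t - p (suc k)) (p k - t) (w k) (w (suc k)) (D ⁻¹))
    }
    where
    D = denominator k t
    0<D = 0<denominator l h
    u = (q k - q (suc k)) * D ⁻¹
    -- Solves `left`; then `right` follows, because `u` was chosen as the solution of the sum of the
    -- two equations.
    s = q (suc k) + (t - p (suc k)) * (u * w (suc k))

  -- The Plücker relation (q - q′)(s - s′) = (s - q′)(q - s′) - (s′ - q′)(q - s) reduces the chord
  -- to the two end equations of each point. The same relation in the source, together with `steps`,
  -- gives the right side.
  chord : ∀ {k t s u t′ s′ u′} → Piece k t s u → Piece k t′ s′ u′ → s - s′ ≈ (t - t′) * (u * u′)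
  chord {k} {t} {s} {u} {t′} {s′} {u′} π π′ = *-cancelˡ (0<⇒≉0 (0<Δq k)) (begin
    (q k - q (suc k)) * (s - s′)
      ≈⟨ solve 4 (λ q q′ s s′ → (q :- q′) :* (s :- s′) := (s :- q′) :* (q :- s′) :- (s′ :- q′) :* (q :- s)) refl
           (q k) (q (suc k)) s s′ ⟩
    (s - q (suc k)) * (q k - s′) - (s′ - q (suc k)) * (q k - s)
      ≈⟨ +-cong (*-cong (left π) (right π′)) (-‿cong (*-cong (left π′) (right π))) ⟩
    ((t - p (suc k)) * (u * w (suc k))) * ((p k - t′) * (u′ * w k)) -
    ((t′ - p (suc k)) * (u′ * w (suc k))) * ((p k - t) * (u * w k))
      ≈⟨ solve 8 (λ p p′ t t′ u u′ w w′ →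
           ((t :- p′) :* (u :* w′)) :* ((p :- t′) :* (u′ :* w)) :-
           ((t′ :- p′) :* (u′ :* w′)) :* ((p :- t) :* (u :* w))
           := ((p :- p′) :* (w :* w′)) :* ((t :- t′) :* (u :* u′))) refl
           (p k) (p (suc k)) t t′ u u′ (w k) (w (suc k)) ⟩
    ((p k - p (suc k)) * (w k * w (suc k))) * ((t - t′) * (u * u′))
      ≈⟨ *-congʳ (steps k) ⟨
    (q k - q (suc k)) * ((t - t′) * (u * u′)) ∎)

  -- The reciprocal of the root is an affine function of t, of slope proportional to w (k + 1) - w
  -- k; this is that fact with the denominators cleared.
  root-difference : ∀ {k t s u t′ s′ u′} → Piece k t s u → Piece k t′ s′ u′ →
    (q k - q (suc k)) * (u - u′) ≈ (u * u′) * ((t′ - t) * (w (suc k) - w k))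
  root-difference {k} {t} {s} {u} {t′} {s′} {u′} π π′ = begin
    (q k - q (suc k)) * (u - u′)
      ≈⟨ solve 3 (λ d u u′ → d :* (u :- u′) := d :* u :- d :* u′) refl _ u u′ ⟩
    (q k - q (suc k)) * u - (q k - q (suc k)) * u′
      ≈⟨ +-cong (*-congʳ (Δq≈root*denominator π′)) (-‿cong (*-congʳ (Δq≈root*denominator π))) ⟩
    (u′ * denominator k t′) * u - (u * denominator k t) * u′
      ≈⟨ solve 8 (λ p p′ t t′ u u′ w w′ →
           (u′ :* ((t′ :- p′) :* w′ :+ (p :- t′) :* w)) :* u :- (u :* ((t :- p′) :* w′ :+ (p :- t) :* w)) :* u′
           := (u :* u′) :* ((t′ :- t) :* (w′ :- w))) refl
           (p k) (p (suc k)) t t′ u u′ (w k) (w (suc k)) ⟩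
    (u * u′) * ((t′ - t) * (w (suc k) - w k)) ∎

  private
    Δq≈ : ∀ k t → q k - q (suc k) ≈ (t - p (suc k)) * (w k * w (suc k)) + (p k - t) * (w k * w (suc k))
    Δq≈ k t = trans (steps k) (solve 4 (λ p p′ t m → (p :- p′) :* m := (t :- p′) :* m :+ (p :- t) :* m) refl
      (p k) (p (suc k)) t _)

  -- By `steps`, u is the mean of `w k` and `w (suc k)` with the nonnegative coefficients (t - p (k
  -- + 1)) w (k + 1) and (p k - t) w k, whose sum is the denominator. Hence common bounds of the two
  -- weights bound u.
  root-≤ : ∀ {k t s u c} → w k ≤ c → w (suc k) ≤ c → Piece k t s u → u ≤ c
  root-≤ {k} {t} {s} {u} {c} w≤c w′≤c π = *-cancelˡ-≤ (0<denominator (lower π) (upper π))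
    (≤-respˡ-≈ (trans (sym (Δq≈ k t)) (trans (Δq≈root*denominator π) (*-comm _ _)))
      (≤-byDifference (0≤+ (*-nonNeg (*-nonNeg (x≤y⇒0≤y-x (lower π)) (<⇒≤ (w>0 (suc k)))) (x≤y⇒0≤y-x w≤c))
                           (*-nonNeg (*-nonNeg (x≤y⇒0≤y-x (upper π)) (<⇒≤ (w>0 k))) (x≤y⇒0≤y-x w′≤c)))
        (solve 5 (λ a b w w′ c → (a :* w′ :+ b :* w) :* c :- (a :* (w :* w′) :+ b :* (w :* w′))
          := (a :* w′) :* (c :- w) :+ (b :* w) :* (c :- w′)) refl
          (t - p (suc k)) (p k - t) (w k) (w (suc k)) c)))

  ≤-root : ∀ {k t s u c} → c ≤ w k → c ≤ w (suc k) → Piece k t s u → c ≤ u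
  ≤-root {k} {t} {s} {u} {c} c≤w c≤w′ π = *-cancelˡ-≤ (0<denominator (lower π) (upper π))
    (≤-respʳ-≈ (trans (sym (Δq≈ k t)) (trans (Δq≈root*denominator π) (*-comm _ _)))
      (≤-byDifference (0≤+ (*-nonNeg (*-nonNeg (x≤y⇒0≤y-x (lower π)) (<⇒≤ (w>0 (suc k)))) (x≤y⇒0≤y-x c≤w))
                           (*-nonNeg (*-nonNeg (x≤y⇒0≤y-x (upper π)) (<⇒≤ (w>0 k))) (x≤y⇒0≤y-x c≤w′)))
        (solve 5 (λ a b w w′ c → (a :* (w :* w′) :+ b :* (w :* w′)) :- (a :* w′ :+ b :* w) :* c
          := (a :* w′) :* (w :- c) :+ (b :* w) :* (w′ :- c)) refl
          (t - p (suc k)) (p k - t) (w k) (w (suc k)) c)))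

  -- The factors w k + w (suc k) bound the two roots and the difference of their weights.
  lipschitz : ℕ → Carrier
  lipschitz k = (q k - q (suc k)) ⁻¹ * ((w k + w (suc k)) * (w k + w (suc k)) * (w k + w (suc k)))

  0≤lipschitz : ∀ k → 0# ≤ lipschitz k
  0≤lipschitz k = <⇒≤ (0<* (0<⁻¹ (0<Δq k)) (0<* (0<* 0<H 0<H) 0<H))
    where
    0<H : 0# < w k + w (suc k)
    0<H = 0<+ (w>0 k) (<⇒≤ (w>0 (suc k)))

  root-lipschitz : ∀ {k t s u t′ s′ u′} → Piece k t s u → Piece k t′ s′ u′ →
    ∣ u - u′ ∣ ≤ lipschitz k * ∣ t - t′ ∣
  root-lipschitz {k} {t} {s} {u} {t′} {s′} {u′} π π′ = *-cancelˡ-≤ (0<Δq k)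
    (≤-respˡ-≈ (∣x*y∣≈x*∣y∣ _ (<⇒≤ (0<Δq k)))
    (≤-respˡ-≈ (∣∣-cong (sym (root-difference π π′)))
    (≤-respˡ-≈ (sym (trans (∣x*y∣≈x*∣y∣ _ (<⇒≤ (0<* (root>0 π) (root>0 π′)))) (*-congˡ (∣x*y∣≈∣x∣*∣y∣ _ _))))
    (≤-respʳ-≈ (sym rearrange)
    (*-mono-≤ (<⇒≤ (0<* (root>0 π) (root>0 π′))) (*-nonNeg (0≤∣∣ _) 0≤H)
      (*-mono-≤ (<⇒≤ (root>0 π)) 0≤H (bound π) (bound π′))
      (*-mono-≤ (0≤∣∣ _) 0≤H (≤-reflexive (∣x-y∣≈∣y-x∣ t′ t)) (∣∣-≤
        (≤-byDifference (0≤+ (<⇒≤ (w>0 k)) (<⇒≤ (w>0 k)))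
          (solve 2 (λ w w′ → (w :+ w′) :- (w′ :- w) := w :+ w) refl (w k) (w (suc k))))
        (≤-byDifference (0≤+ (<⇒≤ (w>0 (suc k))) (<⇒≤ (w>0 (suc k))))
          (solve 2 (λ w w′ → (w :+ w′) :- :- (w′ :- w) := w′ :+ w′) refl (w k) (w (suc k)))))))))))
    where
    H = w k + w (suc k)
    0≤H : 0# ≤ H
    0≤H = 0≤+ (<⇒≤ (w>0 k)) (<⇒≤ (w>0 (suc k)))
    bound : ∀ {t s u} → Piece k t s u → u ≤ H
    bound = root-≤
      (≤-byDifference (<⇒≤ (w>0 (suc k))) (solve 2 (λ w w′ → (w :+ w′) :- w := w′) refl (w k) (w (suc k))))
      (≤-byDifference (<⇒≤ (w>0 k)) (solve 2 (λ w w′ → (w :+ w′) :- w′ := w) refl (w k) (w (suc k))))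
    rearrange : (q k - q (suc k)) * (lipschitz k * ∣ t - t′ ∣) ≈ (H * H) * (∣ t - t′ ∣ * H)
    rearrange = trans (solve 4 (λ d v H a → d :* ((v :* (H :* H :* H)) :* a) := (d :* v) :* ((H :* H) :* (a :* H))) refl
        (q k - q (suc k)) ((q k - q (suc k)) ⁻¹) H (∣ t - t′ ∣))
      (trans (*-congʳ (*-inverseʳ _ (0<⇒≉0 (0<Δq k)))) (*-identityˡ _))

  at-lower : ∀ {k t s u} → Piece k t s u → t ≈ p (suc k) → s ≈ q (suc k) × u ≈ w (suc k)
  at-lower {k} {t} {s} {u} π t≈ = s≈ ,
    *-cancelˡ (0<⇒≉0 (w>0 k)) (*-cancelˡ (0<⇒≉0 (0<Δp k)) (begin
      (p k - p (suc k)) * (w k * u)           ≈⟨ *-cong (+-congˡ (-‿cong (sym t≈))) (*-comm _ _) ⟩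
      (p k - t) * (u * w k)                   ≈⟨ right π ⟨
      q k - s                                 ≈⟨ +-congˡ (-‿cong s≈) ⟩
      q k - q (suc k)                         ≈⟨ steps k ⟩
      (p k - p (suc k)) * (w k * w (suc k))   ∎))
    where
    s≈ : s ≈ q (suc k)
    s≈ = sym (y-x≈0⇒x≈y (trans (left π) (trans (*-congʳ (trans (+-congʳ t≈) (-‿inverseʳ _))) (zeroˡ _))))

  at-upper : ∀ {k t s u} → Piece k t s u → t ≈ p k → s ≈ q k × u ≈ w k
  at-upper {k} {t} {s} {u} π t≈ = s≈ ,
    *-cancelˡ (0<⇒≉0 (w>0 (suc k))) (*-cancelˡ (0<⇒≉0 (0<Δp k)) (begin
      (p k - p (suc k)) * (w (suc k) * u)     ≈⟨ *-cong (+-congʳ (sym t≈)) (*-comm _ _) ⟩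
      (t - p (suc k)) * (u * w (suc k))       ≈⟨ left π ⟨
      s - q (suc k)                           ≈⟨ +-congʳ s≈ ⟩
      q k - q (suc k)                         ≈⟨ steps k ⟩
      (p k - p (suc k)) * (w k * w (suc k))   ≈⟨ *-congˡ (*-comm _ _) ⟩
      (p k - p (suc k)) * (w (suc k) * w k)   ∎))
    where
    s≈ : s ≈ q k
    s≈ = y-x≈0⇒x≈y (trans (right π) (trans (*-congʳ (trans (+-congˡ (-‿cong t≈)) (-‿inverseʳ _))) (zeroˡ _)))

  node-piece : ∀ k → Piece k (p k) (q k) (w k)
  node-piece k = record
    { lower  = <⇒≤ (P.decreasing k)
    ; upper  = ≤-refl
    ; root>0 = w>0 k
    ; left   = steps k
    ; right  = solve 3 (λ q p m → q :- q := (p :- p) :* m) refl (q k) (p k) _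
    }

  private
    adjacent : ∀ {i j t s u s′ u′} → i ℕ.< j → Piece i t s u → Piece j t s′ u′ → s ≈ s′ × u ≈ u′
    adjacent i<j π π′ with ℕ.≤⇒≤′ i<j
    -- Consecutive pieces share only the node `p (suc i)`, where both give the value `q (suc i)` and
    -- the root `w (suc i)`; pieces further apart share no point.
    ... | ℕ.≤′-refl =
      let t≈ = antisym (upper π′) (lower π)
          s≈ , u≈ = at-lower π t≈
          s′≈ , u′≈ = at-upper π′ t≈
      in trans s≈ (sym s′≈) , trans u≈ (sym u′≈)
    ... | ℕ.≤′-step i<j′ = ⊥-elim (<⇒≱
      (<-≤-trans (≤-<-trans (upper π′) (P.decreasing _)) (P.antitone (ℕ.≤′⇒≤ i<j′))) (lower π))

  -- This is the gluing: at a node the pieces on either side agree in the value and also in the root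
  -- of the derivative.
  coherent : ∀ {i j t s u s′ u′} → Piece i t s u → Piece j t s′ u′ → s ≈ s′ × u ≈ u′
  coherent {i} {j} {t} {s} {u} {s′} {u′} π π′ with ℕ.<-cmp i j
  ... | tri≈ _ ≡.refl _ =
    y-x≈0⇒x≈y (trans (chord π′ π) (trans (*-congʳ (-‿inverseʳ t)) (zeroˡ _))) ,
    sym (y-x≈0⇒x≈y (*-cancelˡ (0<⇒≉0 (0<Δq i)) (trans (root-difference π π′)
      (solve 4 (λ m t w d → m :* ((t :- t) :* w) := d :* con (+ 0)) refl _ t _ _)) ))
  ... | tri< i<j _ _ = adjacent i<j π π′
  ... | tri> _ _ j<i = let s≈ , u≈ = adjacent j<i π′ π in sym s≈ , sym u≈

-- The glued map and its continuous derivative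

module InterpolatingMap (em : ∀ {ℓ} → ExcludedMiddle ℓ) (R : CompleteOrderedField)
  (P Q : Interpolation.Nodes em R) (T : Interpolation.Transition em R P Q) where
  open OrderedField em R
  open Reals R
  open Interpolation em R
  open Pieces em R P Q T
  private
    module P = Nodes P
    module Q = Nodes Q
  open P using () renaming (node to p)
  open Q using () renaming (node to q)
  open Transition T renaming (weight to w; weight>0 to w>0)
  open Piece

  -- A relation instead of a function, so that it does not matter which piece is chosen at a node,
  -- and so that the inverse arises by exchanging t and s. The root at 0 is 1, the limit of the
  -- weights.
  Graph : Carrier → Carrier → Carrier → Set
  Graph t s u = (t ≈ 0# × s ≈ 0# × u ≈ 1#) ⊎ Σ[ k ∈ ℕ ] Piece k t s u

  Piece⇒0< : ∀ {k t s u} → Piece k t s u → 0# < t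
  Piece⇒0< π = <-≤-trans (P.positive _) (lower π)

  Graph-unique : ∀ {t s u t′ s′ u′} → t ≈ t′ → Graph t s u → Graph t′ s′ u′ → s ≈ s′ × u ≈ u′
  Graph-unique _ (inj₁ (_ , s≈ , u≈)) (inj₁ (_ , s′≈ , u′≈)) = trans s≈ (sym s′≈) , trans u≈ (sym u′≈)
  Graph-unique t≈t′ (inj₁ (t≈0 , _)) (inj₂ (_ , π)) = ⊥-elim (0<⇒≉0 (Piece⇒0< π) (trans (sym t≈t′) t≈0))
  Graph-unique t≈t′ (inj₂ (_ , π)) (inj₁ (t′≈0 , _)) = ⊥-elim (0<⇒≉0 (Piece⇒0< π) (trans t≈t′ t′≈0))
  Graph-unique t≈t′ (inj₂ (_ , π)) (inj₂ (_ , π′)) = coherent (Piece-resp-≈ t≈t′ refl refl π) π′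

  abstract
    Graph-total : ∀ (x : Point) → Σ[ s ∈ Carrier ] Σ[ u ∈ Carrier ] Graph (proj₁ x) s u
    Graph-total (t , 0≤t , t≤1) with ≤⇒≈⊎< 0≤t
    ... | inj₁ 0≈t = 0# , 1# , inj₁ (sym 0≈t , refl , refl)
    ... | inj₂ 0<t = let k , p′<t , t≤p = P.locate 0<t t≤1
                         s , u , π = Piece-total (<⇒≤ p′<t) t≤p
                     in s , u , inj₂ (k , π)

  value root : Point → Carrier
  value x = proj₁ (Graph-total x)
  root x = proj₁ (proj₂ (Graph-total x))

  graph : ∀ x → Graph (proj₁ x) (value x) (root x)
  graph x = proj₂ (proj₂ (Graph-total x))

  value-in-[0,1] : ∀ x → 0# ≤ value x × value x ≤ 1#
  value-in-[0,1] x with graph x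
  ... | inj₁ (_ , s≈0 , _) = ≤-reflexive (sym s≈0) , ≤-respˡ-≈ (sym s≈0) 0≤1
  ... | inj₂ (k , π) = ≤-trans (<⇒≤ (Q.positive _)) (image-lower π) ,
                       ≤-trans (image-upper π) (≤-respʳ-≈ Q.node-zero (Q.antitone ℕ.z≤n))

  to : Point → Point
  to x = value x , value-in-[0,1] x

  to-cong : ∀ (x y : Point) → proj₁ x ≈ proj₁ y → value x ≈ value y
  to-cong x y x≈y = proj₁ (Graph-unique x≈y (graph x) (graph y))

  to-zero : ∀ (x : Point) → proj₁ x ≈ 0# → value x ≈ 0# × root x ≈ 1#
  to-zero x x≈0 = Graph-unique x≈0 (graph x) (inj₁ (refl , refl , refl))

  to-node : ∀ (x : Point) k → proj₁ x ≈ p k → value x ≈ q k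
  to-node x k x≈p = proj₁ (Graph-unique x≈p (graph x) (inj₂ (k , node-piece k)))

  piece-of : ∀ (x : Point) {k} → p (suc k) ≤ proj₁ x → proj₁ x ≤ p k → Piece k (proj₁ x) (value x) (root x)
  piece-of x l h = let s , u , π = Piece-total l h
                       s≈ , u≈ = Graph-unique refl (inj₂ (_ , π)) (graph x)
                   in Piece-resp-≈ refl s≈ u≈ π

  value-mono-≤ : ∀ (x y : Point) → proj₁ x < proj₁ y → value x ≤ value y
  value-mono-≤ x y x<y with graph x | graph y
  ... | inj₁ (_ , s≈0 , _) | _ = ≤-respˡ-≈ (sym s≈0) (proj₁ (value-in-[0,1] y))
  ... | inj₂ (_ , π) | inj₁ (y≈0 , _) = ⊥-elim (<⇒≱ x<y (≤-respˡ-≈ (sym y≈0) (<⇒≤ (Piece⇒0< π))))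
  ... | inj₂ (i , π) | inj₂ (j , π′) with ℕ.<-cmp i j
  ...   | tri< i<j _ _ = ⊥-elim (<⇒≱ x<y (≤-trans (upper π′) (≤-trans (P.antitone i<j) (lower π))))
  ...   | tri≈ _ ≡.refl _ = ≤-byDifference
            (*-nonNeg (<⇒≤ (x<y⇒0<y-x x<y)) (<⇒≤ (0<* (root>0 π′) (root>0 π)))) (chord π′ π)
  ...   | tri> _ _ j<i = ≤-trans (image-upper π) (≤-trans (Q.antitone j<i) (image-lower π′))

  Neighbours : Point → ℕ → Point → Set
  Neighbours x k y = Piece k (proj₁ x) (value x) (root x) × Piece k (proj₁ y) (value y) (root y)

  -- Only pieces containing x itself are met near x: one if x lies between nodes, two if x is a node
  -- below 1. So every nearby y shares a piece with x, and the chord identity applies to the pair.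
  near-positive : ∀ (x : Point) → 0# < proj₁ x → Σ[ i ∈ ℕ ] Σ[ j ∈ ℕ ] Σ[ δ ∈ Carrier ] 0# < δ ×
    (∀ y → ∣ proj₁ y - proj₁ x ∣ < δ → Neighbours x i y ⊎ Neighbours x j y)
  near-positive x@(t , _ , t≤1) 0<t with P.locate 0<t t≤1
  ... | k , p′<t , t≤p with ≤⇒≈⊎< t≤p
  ...   | inj₂ t<p =
    let δ , 0<δ , δ≤l , δ≤r = min (x<y⇒0<y-x p′<t) (x<y⇒0<y-x t<p)
    in k , k , δ , 0<δ , λ y y~ → inj₁ (piece-of x (<⇒≤ p′<t) t≤p ,
         piece-of y (<⇒≤ (within⇒above δ≤l y~)) (<⇒≤ (within⇒below δ≤r y~)))
  -- At the top node 1 there is no piece above; the bound `y ≤ 1#` of the domain takes its place.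
  near-positive x@(t , _ , t≤1) 0<t | zero , p′<t , t≤p | inj₁ t≈p =
    0 , 0 , t - p 1 , x<y⇒0<y-x p′<t , λ y@(_ , _ , y≤1) y~ → inj₁ (piece-of x (<⇒≤ p′<t) t≤p ,
      piece-of y (≤-respˡ-≈ (solve 2 (λ t a → t :- (t :- a) := a) refl t (p 1)) (<⇒≤ (∣y-x∣<d⇒x-d<y y~)))
        (≤-respʳ-≈ (sym P.node-zero) y≤1))
  near-positive x@(t , _ , t≤1) 0<t | suc j , p′<t , t≤p | inj₁ t≈p =
    let δ , 0<δ , δ≤l , δ≤r = min (x<y⇒0<y-x p′<t) (x<y⇒0<y-x (<-respˡ-≈ (sym t≈p) (P.decreasing j)))
    in suc j , j , δ , 0<δ , λ y y~ → cases y (within⇒above δ≤l y~) (within⇒below δ≤r y~)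
    where
    cases : ∀ y → p (suc (suc j)) < proj₁ y → proj₁ y < p j → Neighbours x (suc j) y ⊎ Neighbours x j y
    cases y l h with total (proj₁ y) t
    ... | inj₁ y≤t = inj₁ (piece-of x (<⇒≤ p′<t) t≤p , piece-of y (<⇒≤ l) (≤-trans y≤t t≤p))
    ... | inj₂ t≤y = inj₂ (piece-of x (≤-reflexive (sym t≈p)) (≤-trans t≤y (<⇒≤ h)) ,
                           piece-of y (≤-respˡ-≈ t≈p t≤y) (<⇒≤ h))

  near-positive-bounds : ∀ (x : Point) → 0# < proj₁ x → Σ[ C ∈ Carrier ] 0# ≤ C × Σ[ δ ∈ Carrier ] 0# < δ ×
    (∀ (y : Point) → ∣ proj₁ y - proj₁ x ∣ < δ →
      value y - value x ≈ (proj₁ y - proj₁ x) * (root y * root x) ×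
      ∣ root y - root x ∣ ≤ C * ∣ proj₁ y - proj₁ x ∣)
  near-positive-bounds x 0<x =
    let i , j , δ , 0<δ , near = near-positive x 0<x
    in lipschitz i + lipschitz j , 0≤+ (0≤lipschitz i) (0≤lipschitz j) , δ , 0<δ ,
       λ y y~ → bounds y i j (near y y~)
    where
    bounds : ∀ y i j → Neighbours x i y ⊎ Neighbours x j y →
      value y - value x ≈ (proj₁ y - proj₁ x) * (root y * root x) ×
      ∣ root y - root x ∣ ≤ (lipschitz i + lipschitz j) * ∣ proj₁ y - proj₁ x ∣
    bounds y i j (inj₁ (πx , πy)) = chord πy πx , ≤-trans (root-lipschitz πy πx)
      (≤-byDifference (*-nonNeg (0≤lipschitz j) (0≤∣∣ _))
        (solve 3 (λ a b z → (a :+ b) :* z :- a :* z := b :* z) refl (lipschitz i) (lipschitz j) _))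
    bounds y i j (inj₂ (πx , πy)) = chord πy πx , ≤-trans (root-lipschitz πy πx)
      (≤-byDifference (*-nonNeg (0≤lipschitz i) (0≤∣∣ _))
        (solve 3 (λ a b z → (a :+ b) :* z :- b :* z := a :* z) refl (lipschitz i) (lipschitz j) _))

  -- A positive x below `p K` lies in a piece of index at least K, where the root is trapped between
  -- weights close to 1. For the value, slopes close to 1 are added from x down to the next node and
  -- on to a common node p i = q i. That node cancels from the displacement, and x - p i ≤ x yields
  -- a bound relative to x.
  near-zero-bounds : ∀ {ε η} → 0# < ε → 0# < η → η ≤ ε →
    (∀ a b → ∣ a - 1# ∣ < η → ∣ b - 1# ∣ < η → ∣ a * b - 1# ∣ ≤ ε) →
    ∀ K → (∀ k → K ℕ.≤ k → ∣ w k - 1# ∣ < ½ * η) →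
    ∀ (x : Point) → proj₁ x < p K → ∣ root x - 1# ∣ < ε × ∣ value x - proj₁ x ∣ ≤ ε * proj₁ x
  near-zero-bounds {ε} {η} 0<ε 0<η η≤ε product~1 K close x x<p = bounds (graph x)
    where
    -- The bounds on a root by its weights are not strict; the factor ½ restores the strict bound by
    -- η that `product~1` asks for.
    ε′ = ½ * η
    ε′<η : ε′ < η
    ε′<η = ½*< 0<η
    w~1 : ∀ {k} → K ℕ.≤ k → ∣ w k - 1# ∣ < η
    w~1 K≤k = <-trans (close _ K≤k) ε′<η
    telescope : ∀ {i j} → K ℕ.≤ i → i ℕ.≤′ j → AlmostIsometric ε (p i) (q i) (p j) (q j)
    telescope {i} K≤i ℕ.≤′-refl = ≤-reflexive (trans (x≈y⇒∣x-y∣≈0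
      (trans (-‿inverseʳ _) (sym (-‿inverseʳ _)))) (sym (trans (*-congˡ (-‿inverseʳ _)) (zeroʳ ε))))
    telescope K≤i (ℕ.≤′-step {j} i≤j) = almost-trans (telescope K≤i i≤j)
      (almost-chord (<⇒≤ (P.decreasing _)) (steps _) (product~1 _ _ (w~1 K≤j) (w~1 (ℕ.m≤n⇒m≤1+n K≤j))))
      where
      K≤j = ℕ.≤-trans K≤i (ℕ.≤′⇒≤ i≤j)
    bounds : Graph (proj₁ x) (value x) (root x) →
             ∣ root x - 1# ∣ < ε × ∣ value x - proj₁ x ∣ ≤ ε * proj₁ x
    bounds (inj₁ (x≈0 , s≈0 , u≈1)) =
      <-respˡ-≈ (sym (x≈y⇒∣x-y∣≈0 u≈1)) 0<ε ,
      ≤-respˡ-≈ (sym (x≈y⇒∣x-y∣≈0 (trans s≈0 (sym x≈0)))) (*-nonNeg (<⇒≤ 0<ε) (proj₁ (proj₂ x)))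
    bounds (inj₂ (k , π)) = <-≤-trans u~1 η≤ε , estimate-value (fixed (suc k))
      where
      K≤k : K ℕ.≤ k
      K≤k = ℕ.≤-pred (P.node<⇒< (≤-<-trans (lower π) x<p))
      K≤1+k = ℕ.m≤n⇒m≤1+n K≤k
      u~1 : ∣ root x - 1# ∣ < η
      u~1 = ∣y-x∣<d
        (≤-<-trans (root-≤ (<⇒≤ (∣y-x∣<d⇒y<x+d (close k K≤k))) (<⇒≤ (∣y-x∣<d⇒y<x+d (close (suc k) K≤1+k))) π)
          (<-respˡ-≈ (+-comm _ _) (<-respʳ-≈ (+-comm _ _) (+-mono-<-≤ ε′<η ≤-refl))))
        (<-≤-trans (<-byDifference (x<y⇒0<y-x ε′<η)
            (solve 2 (λ a b → (con (+ 1) :- b) :- (con (+ 1) :- a) := a :- b) refl η ε′))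
          (≤-root (<⇒≤ (∣y-x∣<d⇒x-d<y (close k K≤k))) (<⇒≤ (∣y-x∣<d⇒x-d<y (close (suc k) K≤1+k))) π))
      estimate-value : Σ[ i ∈ ℕ ] suc k ℕ.≤ i × p i ≈ q i → ∣ value x - proj₁ x ∣ ≤ ε * proj₁ x
      estimate-value (i , k<i , p≈q) = ≤-trans
        (≤-respˡ-≈ (∣∣-cong (≈-byMultiple 1# p≈q
            (solve 4 (λ t s p q → (s :- t) :- ((s :- q) :- (t :- p)) := con (+ 1) :* (q :- p)) refl
              (proj₁ x) (value x) (p i) (q i))))
          (almost-trans (almost-chord (lower π) (left π) (product~1 _ _ u~1 (w~1 K≤1+k)))
                        (telescope K≤1+k (ℕ.≤⇒≤′ k<i))))
        (*-monoˡ-≤ (<⇒≤ 0<ε) (≤-byDifference (<⇒≤ (P.positive i))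
          (solve 2 (λ t p → t :- (t :- p) := p) refl (proj₁ x) (p i))))

  near-zero : ∀ ε → 0# < ε → Σ[ δ ∈ Carrier ] 0# < δ ×
    (∀ (x : Point) → proj₁ x < δ → ∣ root x - 1# ∣ < ε × ∣ value x - proj₁ x ∣ ≤ ε * proj₁ x)
  near-zero ε 0<ε =
    let η₀ , 0<η₀ , estimate = product-estimate 1# 1# ε 0<ε
        η , 0<η , η≤η₀ , η≤ε = min 0<η₀ 0<ε
        K , close = weight→1 (½ * η) (0<* 0<½ 0<η)
    in p K , P.positive K , near-zero-bounds 0<ε 0<η η≤ε
         (λ a b a~ b~ → <⇒≤ (<-respˡ-≈ (∣∣-cong (+-congˡ (-‿cong (*-identityˡ 1#))))
           (estimate a b (<-≤-trans a~ η≤η₀) (<-≤-trans b~ η≤η₀)))) K close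

  root-continuous : Continuous root
  root-continuous x ε 0<ε with ≤⇒≈⊎< (proj₁ (proj₂ x))
  ... | inj₁ 0≈x =
    let δ , 0<δ , near = near-zero ε 0<ε
    in δ , 0<δ , λ y y~ →
      <-respˡ-≈ (∣∣-cong (+-congˡ (-‿cong (sym (proj₂ (to-zero x (sym 0≈x)))))))
        (proj₁ (near y (<-respˡ-≈ (y≈0⇒∣x-y∣≈x (sym 0≈x) (proj₁ (proj₂ y))) y~)))
  ... | inj₂ 0<x =
    let C , 0≤C , δ₁ , 0<δ₁ , near = near-positive-bounds x 0<x
        δ₂ , 0<δ₂ , small = small-multiples 0≤C 0<ε
        δ , 0<δ , δ≤δ₁ , δ≤δ₂ = min 0<δ₁ 0<δ₂
    in δ , 0<δ , λ y y~ → ≤-<-trans (proj₂ (near y (<-≤-trans y~ δ≤δ₁)))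
                            (small _ (<-≤-trans y~ δ≤δ₂) (0≤∣∣ _))

  value-derivative : ∀ x → HasDerivativeAt value x (root x * root x)
  value-derivative x ε 0<ε with ≤⇒≈⊎< (proj₁ (proj₂ x))
  ... | inj₁ 0≈x =
    -- Half of ε, because `near-zero` bounds the displacement only weakly.
    let δ , 0<δ , near = near-zero (½ * ε) (0<* 0<½ 0<ε)
    in δ , 0<δ , λ y y≉x y~ →
      let y≈∣y-x∣ = y≈0⇒∣x-y∣≈x (sym 0≈x) (proj₁ (proj₂ y)) in
      ≤-<-trans (quotient-estimate (x≉y⇒x-y≉0 y≉x)
        (≤-respˡ-≈ (∣∣-cong (at-zero y)) (≤-respʳ-≈ (*-congˡ (sym y≈∣y-x∣))
          (proj₂ (near y (<-respˡ-≈ y≈∣y-x∣ y~))))))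
        (½*< 0<ε)
    where
    at-zero : ∀ (y : Point) → value y - proj₁ y ≈ (value y - value x) - (root x * root x) * (proj₁ y - proj₁ x)
    at-zero y = let s≈0 , u≈1 = to-zero x (sym 0≈x) in sym (trans
      (+-cong (+-congˡ (-‿cong s≈0)) (-‿cong (*-cong (*-cong u≈1 u≈1) (+-congˡ (-‿cong (sym 0≈x))))))
      (solve 2 (λ s t → (s :- con (+ 0)) :- (con (+ 1) :* con (+ 1)) :* (t :- con (+ 0)) := s :- t) refl
        (value y) (proj₁ y)))
  ... | inj₂ 0<x =
    let C , 0≤C , δ₁ , 0<δ₁ , near = near-positive-bounds x 0<x
        η , 0<η , estimate = product-estimate (root x) (root x) ε 0<ε
        δ₂ , 0<δ₂ , near₂ = root-continuous x η 0<η
        δ , 0<δ , δ≤δ₁ , δ≤δ₂ = min 0<δ₁ 0<δ₂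
    in δ , 0<δ , λ y y≉x y~ → <-respˡ-≈
         (∣∣-cong (+-congʳ (sym (quotient y y≉x (proj₁ (near y (<-≤-trans y~ δ≤δ₁)))))))
         (estimate (root y) (root x) (near₂ y (<-≤-trans y~ δ≤δ₂)) (<-respˡ-≈ (sym (x≈y⇒∣x-y∣≈0 refl)) 0<η))
    where
    quotient : ∀ (y : Point) → ¬ proj₁ y ≈ proj₁ x → value y - value x ≈ (proj₁ y - proj₁ x) * (root y * root x) →
      (value y - value x) * (proj₁ y - proj₁ x) ⁻¹ ≈ root y * root x
    quotient y y≉x eq = let z = proj₁ y - proj₁ x in trans (*-congʳ eq)
      (trans (solve 3 (λ z m v → (z :* m) :* v := m :* (z :* v)) refl z (root y * root x) (z ⁻¹))
        (trans (*-congˡ (*-inverseʳ z (x≉y⇒x-y≉0 y≉x))) (*-identityʳ _)))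

  value-C¹ : C¹ value
  value-C¹ = (λ x → root x * root x) , value-derivative , *-continuous root-continuous root-continuous

  value-continuous : Continuous value
  value-continuous = differentiable⇒continuous to-cong value-derivative

-- Transitions give diffeomorphisms

module Diffeomorphisms (em : ∀ {ℓ} → ExcludedMiddle ℓ) (R : CompleteOrderedField) where
  open OrderedField em R
  open Reals R
  open Interpolation em R

  module _ {P Q : Nodes} (T : Transition P Q) where
    private
      module P = Nodes P
      module Q = Nodes Q
      module T = Transition T
      module Forth = InterpolatingMap em R P Q T
      module Back = InterpolatingMap em R Q P (swap T)
      module Piece = Pieces.Piece

    -- The equations of a piece are symmetric: dividing them by the product of the root and the
    -- weight exchanges source and target and inverts both factors.
    Graph-swap : ∀ {t s u} → Forth.Graph t s u → Σ[ u′ ∈ Carrier ] Back.Graph s t u′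
    Graph-swap (inj₁ (t≈0 , s≈0 , _)) = 1# , inj₁ (s≈0 , t≈0 , refl)
    Graph-swap {u = u} (inj₂ (k , π)) = u ⁻¹ , inj₂ (k , record
      { lower  = Pieces.image-lower em R P Q T π
      ; upper  = Pieces.image-upper em R P Q T π
      ; root>0 = 0<⁻¹ (Piece.root>0 π)
      ; left   = divide-product (Piece.root>0 π) (T.weight>0 (suc k)) (Piece.left π)
      ; right  = divide-product (Piece.root>0 π) (T.weight>0 k) (Piece.right π)
      })

    -- Not an instance of `Graph-swap` at `swap T`, which would have the weights `w ⁻¹ ⁻¹`; these
    -- first have to be identified with `w`.
    Graph-unswap : ∀ {t s u} → Back.Graph s t u → Σ[ u′ ∈ Carrier ] Forth.Graph t s u′
    Graph-unswap (inj₁ (s≈0 , t≈0 , _)) = 1# , inj₁ (t≈0 , s≈0 , refl)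
    Graph-unswap {u = u} (inj₂ (k , π)) = u ⁻¹ , inj₂ (k , record
      { lower  = Pieces.image-lower em R Q P (swap T) π
      ; upper  = Pieces.image-upper em R Q P (swap T) π
      ; root>0 = 0<⁻¹ (Piece.root>0 π)
      ; left   = trans (divide-product (Piece.root>0 π) (0<⁻¹ (T.weight>0 (suc k))) (Piece.left π))
                   (*-congˡ (*-congˡ (⁻¹-involutive (T.weight>0 (suc k)))))
      ; right  = trans (divide-product (Piece.root>0 π) (0<⁻¹ (T.weight>0 k)) (Piece.right π))
                   (*-congˡ (*-congˡ (⁻¹-involutive (T.weight>0 k))))
      })

    forth∘back : ∀ (x y : Point) → proj₁ y ≈ Back.value x → Forth.value y ≈ proj₁ x
    forth∘back x y y≈ = proj₁ (Forth.Graph-unique y≈ (Forth.graph y) (proj₂ (Graph-unswap (Back.graph x))))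

    back∘forth : ∀ (x y : Point) → proj₁ y ≈ Forth.value x → Back.value y ≈ proj₁ x
    back∘forth x y y≈ = proj₁ (Back.Graph-unique y≈ (Back.graph y) (proj₂ (Graph-swap (Forth.graph x))))

    diffeomorphism : Diff
    diffeomorphism = record
      { homeomorphism = record
        { bijection = record
          { to        = Forth.to
          ; from      = Back.to
          ; to-cong   = λ {x} {y} → Forth.to-cong x y
          ; from-cong = λ {x} {y} → Back.to-cong x y
          ; inverse   = (λ {x} {y} → forth∘back x y) , (λ {x} {y} → back∘forth x y)
          }
        -- Monotonicity of the value is weak; strictness comes from injectivity, through the
        -- inverse.
        ; increasing      = λ x y x<y → Forth.value-mono-≤ x y x<y , λ eq →
            proj₂ x<y (trans (sym (back∘forth x (Forth.to x) refl)) (back∘forth y (Forth.to x) eq))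
        ; to-continuous   = Forth.value-continuous
        ; from-continuous = Back.value-continuous
        }
      ; to-C¹   = Forth.value-C¹
      ; from-C¹ = Back.value-C¹
      }

  nodePoints : Nodes → Pred Point 0ℓ
  nodePoints P x = proj₁ x ≈ 0# ⊎ Σ[ k ∈ ℕ ] proj₁ x ≈ Nodes.node P k

  zero-point one-point : Point
  zero-point = 0# , ≤-refl , 0≤1
  one-point = 1# , 0≤1 , ≤-refl

  transition⇒equivalent : ∀ {P Q} → Transition P Q →
    Σ[ g ∈ Diff ] image (Diff.to g) (nodePoints P) ≐ nodePoints Q
  transition⇒equivalent {P} {Q} T = diffeomorphism T , (λ {y} → image⊆ {y}) , (λ {y} → ⊆image {y})
    where
    module F = InterpolatingMap em R P Q T
    image⊆ : ∀ {y} → image F.to (nodePoints P) y → nodePoints Q y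
    image⊆ (x , inj₁ x≈0 , eq) = inj₁ (trans (sym eq) (proj₁ (F.to-zero x x≈0)))
    image⊆ (x , inj₂ (k , x≈p) , eq) = inj₂ (k , trans (sym eq) (F.to-node x k x≈p))
    ⊆image : ∀ {y} → nodePoints Q y → image F.to (nodePoints P) y
    ⊆image (inj₁ y≈0) = zero-point , inj₁ refl , trans (proj₁ (F.to-zero zero-point refl)) (sym y≈0)
    ⊆image (inj₂ (k , y≈q)) = Nodes.node-point P k , inj₂ (k , refl) ,
      trans (F.to-node (Nodes.node-point P k) k refl) (sym y≈q)

  -- Diffeomorphisms between node sets preserve indices

  below-node : ∀ P k (x : Point) → nodePoints P x → proj₁ x < Nodes.node P k → proj₁ x ≤ Nodes.node P (suc k)
  below-node P k x (inj₁ x≈0) _ = ≤-respˡ-≈ (sym x≈0) (<⇒≤ (Nodes.positive P (suc k)))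
  below-node P k x (inj₂ (j , x≈p)) x<p =
    ≤-respˡ-≈ (sym x≈p) (Nodes.antitone P (Nodes.node<⇒< P (<-respˡ-≈ x≈p x<p)))

  module _ {P Q : Nodes} (g : Diff) (g-image : image (Diff.to g) (nodePoints P) ≐ nodePoints Q) where
    private
      module P = Nodes P
      module Q = Nodes Q
    open Diff g using (to; from; increasing; bijection)
    open Inverse bijection using (to-cong; inverseˡ; inverseʳ)

    to-mono-≤ : ∀ (x y : Point) → proj₁ x ≤ proj₁ y → proj₁ (to x) ≤ proj₁ (to y)
    to-mono-≤ x y x≤y with ≤⇒≈⊎< x≤y
    ... | inj₁ x≈y = ≤-reflexive (to-cong x≈y)
    ... | inj₂ x<y = <⇒≤ (increasing x y x<y)

    to-zero≈0 : ∀ (x : Point) → proj₁ x ≈ 0# → proj₁ (to x) ≈ 0#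
    to-zero≈0 x x≈0 = antisym
      (≤-respʳ-≈ (inverseˡ {x = zero-point} refl)
        (to-mono-≤ x (from zero-point) (≤-respˡ-≈ (sym x≈0) (proj₁ (proj₂ (from zero-point))))))
      (proj₁ (proj₂ (to x)))

    -- Induction on k: node k + 1 is the largest point of its set below node k, and an increasing
    -- bijection of the sets preserves this. The start is that a monotone surjection of [0,1] fixes
    -- 1.
    to-node≈node : ∀ k → proj₁ (to (P.node-point k)) ≈ Q.node k
    to-node≈node zero = antisym (≤-respʳ-≈ (sym Q.node-zero) (proj₂ (proj₂ (to (P.node-point 0)))))
      (≤-respˡ-≈ (trans (inverseˡ {x = one-point} refl) (sym Q.node-zero))
        (to-mono-≤ (from one-point) (P.node-point 0) (≤-respʳ-≈ (sym P.node-zero) (proj₂ (proj₂ (from one-point))))))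
    to-node≈node (suc k) = antisym
      (below-node Q k (to (P.node-point (suc k)))
        (proj₁ g-image {to (P.node-point (suc k))} (P.node-point (suc k) , inj₂ (suc k , refl) , refl))
        (<-respʳ-≈ (to-node≈node k) (increasing _ _ (P.decreasing k))))
      (preimage (proj₂ g-image {Q.node-point (suc k)} (inj₂ (suc k , refl))))
      where
      preimage : image to (nodePoints P) (Q.node-point (suc k)) → Q.node (suc k) ≤ proj₁ (to (P.node-point (suc k)))
      preimage (z , z∈ , eq) = ≤-respˡ-≈ eq (to-mono-≤ z (P.node-point (suc k)) (below-node P k z z∈ z<p))
        where
        z<p : proj₁ z < P.node k
        z<p with ≤⊎> (P.node k) (proj₁ z)
        ... | inj₂ z<p = z<p
        ... | inj₁ p≤z = ⊥-elim (<⇒≱ (Q.decreasing k)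
          (≤-respˡ-≈ (to-node≈node k) (≤-respʳ-≈ eq (to-mono-≤ (P.node-point k) z p≤z))))

    from-zero≈0 : ∀ (x : Point) → proj₁ x ≈ 0# → proj₁ (from x) ≈ 0#
    from-zero≈0 x x≈0 = inverseʳ {x = zero-point} {y = x} (trans x≈0 (sym (to-zero≈0 zero-point refl)))

    from-node≈node : ∀ k → proj₁ (from (Q.node-point k)) ≈ P.node k
    from-node≈node k = inverseʳ {x = P.node-point k} {y = Q.node-point k} (sym (to-node≈node k))

  -- Mean value inequality by real induction

  supremum-approximated : ∀ (P : Pred Carrier 0ℓ) s → (∀ b → UpperBound P b → s ≤ b) →
    ∀ δ → 0# < δ → Σ[ t ∈ Carrier ] P t × s - δ < t
  supremum-approximated P s s-least δ 0<δ with em {P = Σ[ t ∈ Carrier ] P t × s - δ < t}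
  ... | yes found = found
  ... | no none = ⊥-elim (<⇒≱ (<-byDifference 0<δ (solve 2 (λ s δ → s :- (s :- δ) := δ) refl s δ))
    (s-least (s - δ) bounded))
    where
    bounded : ∀ t → P t → t ≤ s - δ
    bounded t t∈ with ≤⊎> t (s - δ)
    ... | inj₁ le = le
    ... | inj₂ lt = ⊥-elim (none (t , t∈ , lt))

  -- Real induction: the supremum of the points reached from a is reached, and no point
  -- before b can be the supremum.
  local⇒global : (_∼_ : Point → Point → Set) → (∀ {x y z} → x ∼ y → y ∼ z → x ∼ z) →
    ∀ (a b : Point) → proj₁ a ≤ proj₁ b →
    (∀ (x : Point) → proj₁ a ≤ proj₁ x → proj₁ x ≤ proj₁ b → Σ[ δ ∈ Carrier ] 0# < δ ×
      (∀ (y : Point) → ∣ proj₁ y - proj₁ x ∣ < δ →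
        (proj₁ y ≤ proj₁ x → y ∼ x) × (proj₁ x ≤ proj₁ y → x ∼ y))) →
    a ∼ b
  local⇒global _∼_ ∼-trans a b a≤b local =
    let s , s-upper , s-least = supremum Reached (proj₁ a , a-reached) (proj₁ b , λ t (_ , _ , _ , t≤b , _) → t≤b)
        δ , 0<δ , near-c = local (c s s-upper s-least) (a≤s s s-upper s-least) (s≤b s s-upper s-least)
    in conclude s s-upper s-least δ 0<δ near-c (≤⇒≈⊎< (s≤b s s-upper s-least))
    where
    Reached : Pred Carrier 0ℓ
    Reached t = Σ[ x ∈ Point ] proj₁ x ≈ t × proj₁ a ≤ t × t ≤ proj₁ b × a ∼ x

    -- The relation is not assumed reflexive or compatible with `≈`. Both come from the local
    -- hypothesis, since a point equal to x is within every δ of it.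
    ∼-near : ∀ x → proj₁ a ≤ proj₁ x → proj₁ x ≤ proj₁ b → ∀ (y : Point) → proj₁ y ≈ proj₁ x → y ∼ x
    ∼-near x a≤x x≤b y y≈x = let δ , 0<δ , near = local x a≤x x≤b
      in proj₁ (near y (<-respˡ-≈ (sym (x≈y⇒∣x-y∣≈0 y≈x)) 0<δ)) (≤-reflexive y≈x)

    a-reached : Reached (proj₁ a)
    a-reached = a , refl , ≤-refl , a≤b , ∼-near a ≤-refl a≤b a refl

    module _ (s : Carrier) (s-upper : UpperBound Reached s) (s-least : ∀ b → UpperBound Reached b → s ≤ b) where
      a≤s : proj₁ a ≤ s
      a≤s = s-upper (proj₁ a) a-reached

      s≤b : s ≤ proj₁ b
      s≤b = s-least (proj₁ b) (λ t (_ , _ , _ , t≤b , _) → t≤b)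

      c : Point
      c = s , ≤-trans (proj₁ (proj₂ a)) a≤s , ≤-trans s≤b (proj₂ (proj₂ b))

      module _ (δ : Carrier) (0<δ : 0# < δ) (near-c : ∀ (y : Point) → ∣ proj₁ y - s ∣ < δ →
        (proj₁ y ≤ s → y ∼ c) × (s ≤ proj₁ y → c ∼ y)) where

        a∼c : a ∼ c
        a∼c = let t , t∈@(x , x≈t , _ , _ , a∼x) , lt = supremum-approximated Reached s s-least δ 0<δ
                  t≤s = s-upper t t∈
              in ∼-trans a∼x (proj₁ (near-c x (∣y-x∣<d
                   (≤-<-trans (≤-respˡ-≈ (sym x≈t) t≤s)
                      (<-byDifference 0<δ (solve 2 (λ s δ → (s :+ δ) :- s := δ) refl s δ)))
                   (<-respʳ-≈ (sym x≈t) lt))) (≤-respˡ-≈ (sym x≈t) t≤s))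

        unsurpassed : ∀ m → 0# < m → m ≤ ½ * δ → m ≤ proj₁ b - s → ⊥
        unsurpassed m 0<m m≤½δ m≤b-s = <⇒≱ s<s+m (s-upper (s + m)
          (y , refl , ≤-trans a≤s (<⇒≤ s<s+m) , s+m≤b , ∼-trans a∼c c∼y))
          where
          s<s+m : s < s + m
          s<s+m = <-byDifference 0<m (solve 2 (λ s m → (s :+ m) :- s := m) refl s m)
          s+m≤b : s + m ≤ proj₁ b
          s+m≤b = ≤-byDifference (x≤y⇒0≤y-x m≤b-s)
            (solve 3 (λ s m b → b :- (s :+ m) := (b :- s) :- m) refl s m (proj₁ b))
          y : Point
          y = s + m , ≤-trans (proj₁ (proj₂ c)) (<⇒≤ s<s+m) , ≤-trans s+m≤b (proj₂ (proj₂ b))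
          c∼y : c ∼ y
          c∼y = proj₂ (near-c y (<-respˡ-≈ (trans (sym (0≤x⇒∣x∣≈x (<⇒≤ 0<m)))
            (∣∣-cong (solve 2 (λ s m → m := (s :+ m) :- s) refl s m)))
            (≤-<-trans m≤½δ (½*< 0<δ)))) (<⇒≤ s<s+m)

        conclude : s ≈ proj₁ b ⊎ s < proj₁ b → a ∼ b
        conclude (inj₁ s≈b) = ∼-trans a∼c (∼-near b a≤b ≤-refl c s≈b)
        conclude (inj₂ s<b) = let m , 0<m , m≤½δ , m≤b-s = min (0<* 0<½ 0<δ) (x<y⇒0<y-x s<b)
                              in ⊥-elim (unsurpassed m 0<m m≤½δ m≤b-s)

  -- Near each point the difference quotients give the estimate for chords ending there, and
  -- additivity of `AlmostIsometric` is the transitivity that real induction needs.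
  almost-isometric-by-derivative : ∀ {f f′ : Point → Carrier} {ε} →
    (∀ (x y : Point) → proj₁ x ≈ proj₁ y → f x ≈ f y) → 0# ≤ ε →
    (∀ x → HasDerivativeAt f x (f′ x)) → ∀ (a b : Point) → proj₁ a ≤ proj₁ b →
    (∀ x → proj₁ x ≤ proj₁ b → ∣ f′ x - 1# ∣ < ε) →
    AlmostIsometric ε (proj₁ b) (f b) (proj₁ a) (f a)
  almost-isometric-by-derivative {f} {f′} {ε} f-cong 0≤ε deriv a b a≤b f′~1 =
    local⇒global (λ x y → AlmostIsometric ε (proj₁ y) (f y) (proj₁ x) (f x))
      (λ p q → almost-trans q p) a b a≤b local
    where
    local : ∀ (x : Point) → proj₁ a ≤ proj₁ x → proj₁ x ≤ proj₁ b → Σ[ δ ∈ Carrier ] 0# < δ ×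
      (∀ (y : Point) → ∣ proj₁ y - proj₁ x ∣ < δ →
        (proj₁ y ≤ proj₁ x → AlmostIsometric ε (proj₁ x) (f x) (proj₁ y) (f y)) ×
        (proj₁ x ≤ proj₁ y → AlmostIsometric ε (proj₁ y) (f y) (proj₁ x) (f x)))
    local x _ x≤b =
      -- The strict bound on the derivative at `x` leaves this margin for the difference quotient.
      let δ , 0<δ , near = deriv x (ε - ∣ f′ x - 1# ∣) (x<y⇒0<y-x (f′~1 x x≤b))
      in δ , 0<δ , λ y y~ → let bound = two-sided y (λ ne → near y ne y~) in
           (λ y≤x → ≤-respˡ-≈ (trans (∣x-y∣≈∣y-x∣ _ _) (∣∣-cong (solve 4 (λ t s t′ s′ →
                (t :- t′) :- (s :- s′) := (s′ :- s) :- (t′ :- t)) refl (proj₁ y) (f y) (proj₁ x) (f x))))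
              (≤-respʳ-≈ (*-congˡ (trans (∣x-y∣≈∣y-x∣ _ _) (0≤x⇒∣x∣≈x (x≤y⇒0≤y-x y≤x)))) bound)) ,
           (λ x≤y → ≤-respʳ-≈ (*-congˡ (0≤x⇒∣x∣≈x (x≤y⇒0≤y-x x≤y))) bound)
      where
      two-sided : ∀ (y : Point) → (¬ proj₁ y ≈ proj₁ x →
          ∣ (f y - f x) * (proj₁ y - proj₁ x) ⁻¹ - f′ x ∣ < ε - ∣ f′ x - 1# ∣) →
        ∣ (f y - f x) - (proj₁ y - proj₁ x) ∣ ≤ ε * ∣ proj₁ y - proj₁ x ∣
      two-sided y near with em {P = proj₁ y ≈ proj₁ x}
      ... | yes y≈x = ≤-respˡ-≈ (sym (x≈y⇒∣x-y∣≈0 (trans (y-x≈0 (f-cong y x y≈x)) (sym (y-x≈0 y≈x)))))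
                        (*-nonNeg 0≤ε (0≤∣∣ _))
        where
        y-x≈0 : ∀ {x y} → x ≈ y → x - y ≈ 0#
        y-x≈0 eq = trans (+-congʳ eq) (-‿inverseʳ _)
      ... | no y≉x = ≤-respˡ-≈ (trans (sym (∣x*y∣≈∣x∣*∣y∣ _ _)) (∣∣-cong (≈-byMultiple (f y - f x) (*-inverseʳ z (x≉y⇒x-y≉0 y≉x))
            (solve 3 (λ a z v → (a :- z) :- z :* (a :* v :- con (+ 1)) := a :* (con (+ 1) :- z :* v))
               refl (f y - f x) z (z ⁻¹)))))
          (≤-respʳ-≈ (*-comm _ _) (*-monoˡ-≤ (0≤∣∣ z) quotient~1))
        where
        z = proj₁ y - proj₁ x
        quotient~1 : ∣ (f y - f x) * z ⁻¹ - 1# ∣ ≤ ε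
        quotient~1 = ≤-trans (≤-respˡ-≈ (∣∣-cong (solve 2 (λ a d → (a :- d) :+ (d :- con (+ 1)) := a :- con (+ 1)) refl
              ((f y - f x) * z ⁻¹) (f′ x))) (∣x+y∣≤∣x∣+∣y∣ _ _))
            (≤-respʳ-≈ (solve 2 (λ e d → (e :- d) :+ d := e) refl ε (∣ f′ x - 1# ∣))
              (+-mono-≤ (<⇒≤ (near y≉x)) ≤-refl))

  -- Asymptotic ratios of gaps under a diffeomorphism

  module _ {P Q : Nodes} (g : Diff) (g-image : image (Diff.to g) (nodePoints P) ≐ nodePoints Q)
    (fixed : ∀ k → Σ[ i ∈ ℕ ] k ℕ.≤ i × Nodes.node P i ≈ Nodes.node Q i) where
    private
      module P = Nodes P
      module Q = Nodes Q
      f f′ : Point → Carrier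
      -- The inverse of `g` carries the gaps of Q to those of P, so the ratios come out as x n / y
      -- n, the form that `c₀×` uses.
      f x = proj₁ (Diff.from g x)
      f′ = proj₁ (Diff.from-C¹ g)

      deriv : ∀ x → HasDerivativeAt f x (f′ x)
      deriv = proj₁ (proj₂ (Diff.from-C¹ g))

      f-cong : ∀ (x y : Point) → proj₁ x ≈ proj₁ y → f x ≈ f y
      f-cong x y = Inverse.from-cong (Diff.bijection g) {x} {y}

    -- At the common nodes, which tend to 0, the difference quotient from 0 is exactly 1.
    derivative-at-zero : f′ zero-point ≈ 1#
    derivative-at-zero = ∣x-y∣≤0⇒x≈y (≤0-if-<-all λ ε 0<ε →
      let δ , 0<δ , near = deriv zero-point ε 0<ε
          k , qk<δ = Q.vanishing δ 0<δ
          i , k≤i , p≈q = fixed k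
      in approximate i p≈q (near (Q.node-point i) (0<⇒≉0 (Q.positive i))
           (<-respˡ-≈ (sym (y≈0⇒∣x-y∣≈x refl (<⇒≤ (Q.positive i)))) (≤-<-trans (Q.antitone k≤i) qk<δ))))
      where
      approximate : ∀ {ε} i → P.node i ≈ Q.node i →
        ∣ (f (Q.node-point i) - f zero-point) * (Q.node i - 0#) ⁻¹ - f′ zero-point ∣ < ε →
        ∣ f′ zero-point - 1# ∣ < ε
      approximate i p≈q = <-respˡ-≈ (trans (∣x-y∣≈∣y-x∣ _ _) (∣∣-cong (+-congˡ (-‿cong quotient≈1))))
        where
        q-0≈q : Q.node i - 0# ≈ Q.node i
        q-0≈q = solve 1 (λ q → q :- con (+ 0) := q) refl (Q.node i)
        quotient≈1 : (f (Q.node-point i) - f zero-point) * (Q.node i - 0#) ⁻¹ ≈ 1#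
        quotient≈1 = trans (*-congʳ (+-cong (trans (from-node≈node {P} {Q} g g-image i) p≈q)
            (-‿cong (from-zero≈0 {P} {Q} g g-image zero-point refl))))
          (*-inverseʳ _ λ eq → 0<⇒≉0 (Q.positive i) (trans (sym q-0≈q) eq))

    steps-asymptotic : ∀ ε → 0# < ε → Σ[ K ∈ ℕ ] (∀ k → K ℕ.≤ k →
      AlmostIsometric ε (Q.node k) (P.node k) (Q.node (suc k)) (P.node (suc k)))
    steps-asymptotic ε 0<ε =
      let δ , 0<δ , near = proj₂ (proj₂ (Diff.from-C¹ g)) zero-point ε 0<ε
          K , qK<δ = Q.vanishing δ 0<δ
      in K , λ k K≤k → transport k (almost-isometric-by-derivative {f} {f′} f-cong (<⇒≤ 0<ε) deriv
           (Q.node-point (suc k)) (Q.node-point k) (<⇒≤ (Q.decreasing k))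
           λ x x≤q → <-respˡ-≈ (∣∣-cong (+-congˡ (-‿cong derivative-at-zero)))
             (near x (<-respˡ-≈ (sym (y≈0⇒∣x-y∣≈x refl (proj₁ (proj₂ x))))
               (≤-<-trans x≤q (≤-<-trans (Q.antitone K≤k) qK<δ)))))
      where
      transport : ∀ k →
        AlmostIsometric ε (Q.node k) (f (Q.node-point k)) (Q.node (suc k)) (f (Q.node-point (suc k))) →
        AlmostIsometric ε (Q.node k) (P.node k) (Q.node (suc k)) (P.node (suc k))
      transport k = ≤-respˡ-≈ (∣∣-cong (+-congʳ (+-cong (from-node≈node {P} {Q} g g-image k)
        (-‿cong (from-node≈node {P} {Q} g g-image (suc k))))))

-- Encoding sequences by nodes

module Encoding (em : ∀ {ℓ} → ExcludedMiddle ℓ) (R : CompleteOrderedField) where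
  open OrderedField em R
  open Reals R
  open Interpolation em R

  0<suc : ∀ n → 0# < ⟦ + suc n ⟧ℤ
  0<suc zero = 0<1
  0<suc (suc n) = 0<+ (0<suc n) 0≤1

  -- The argument is halved before recursing, in step with the recursion of `nodeAt` and `gap`.
  halve : Carrier → ℕ → Carrier
  halve E zero = E
  halve E (suc n) = halve (½ * E) n

  halve>0 : ∀ {E} → 0# < E → ∀ n → 0# < halve E n
  halve>0 0<E zero = 0<E
  halve>0 0<E (suc n) = halve>0 (0<* 0<½ 0<E) n

  halve-suc : ∀ E n → halve E (suc n) ≈ ½ * halve E n
  halve-suc E zero = refl
  halve-suc E (suc n) = halve-suc (½ * E) n

  -- Twice a lower bound of the sequence is again one, so the supremum of the
  -- lower bounds cannot be positive.
  halve-vanishing : ∀ {E} → 0# < E → ∀ ε → 0# < ε → Σ[ n ∈ ℕ ] halve E n < ε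
  halve-vanishing {E} 0<E ε 0<ε with em {P = Σ[ n ∈ ℕ ] halve E n < ε}
  ... | yes found = found
  ... | no none =
    let s , upper , least = supremum Below (ε , ε-below) (E , λ z z-below → z-below 0)
    in ⊥-elim (no-supremum s upper least)
    where
    Below : Pred Carrier 0ℓ
    Below z = ∀ n → z ≤ halve E n
    ε-below : Below ε
    ε-below n with ≤⊎> ε (halve E n)
    ... | inj₁ le = le
    ... | inj₂ lt = ⊥-elim (none (n , lt))
    no-supremum : ∀ s → UpperBound Below s → (∀ b → UpperBound Below b → s ≤ b) → ⊥
    no-supremum s upper least = <⇒≱
      (<-byDifference (<-≤-trans 0<ε (upper ε ε-below)) (solve 1 (λ s → (s :+ s) :- s := s) refl s))
      (upper (s + s) λ n → ≤-respʳ-≈ (½*+½* (halve E n)) (≤-respʳ-≈ (+-cong (halve-suc E n) (halve-suc E n))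
        (+-mono-≤ (s-below (suc n)) (s-below (suc n)))))
      where
      s-below : Below s
      s-below n = least (halve E n) λ z z-below → z-below n

  UnitSequence : Set
  UnitSequence = Space.Carrier (⟨0,1⟩ ^ℕ)

  tail : UnitSequence → UnitSequence
  tail x n = x (suc n)

  block : ℕ → ℕ
  block (suc (suc (suc (suc k)))) = suc (block k)
  block _ = 0

  n*4≤k⇒n≤block : ∀ n k → n ℕ.* 4 ℕ.≤ k → n ℕ.≤ block k
  n*4≤k⇒n≤block zero k _ = ℕ.z≤n
  n*4≤k⇒n≤block (suc n) (suc (suc (suc (suc k)))) (ℕ.s≤s (ℕ.s≤s (ℕ.s≤s (ℕ.s≤s le)))) = ℕ.s≤s (n*4≤k⇒n≤block n k le)

  -- The block [4E , 8E] is cut at 4E + 2xE, and both parts are bisected; the next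
  -- block lies below it at half the scale.
  nodeAt : Carrier → UnitSequence → ℕ → Carrier
  nodeAt E x 0 = ⟦ + 8 ⟧ℤ * E
  nodeAt E x 1 = (⟦ + 6 ⟧ℤ + proj₁ (x 0)) * E
  nodeAt E x 2 = (⟦ + 4 ⟧ℤ + (proj₁ (x 0) + proj₁ (x 0))) * E
  nodeAt E x 3 = (⟦ + 4 ⟧ℤ + proj₁ (x 0)) * E
  nodeAt E x (suc (suc (suc (suc k)))) = nodeAt (½ * E) (tail x) k

  gap : Carrier → UnitSequence → ℕ → Carrier
  gap E x 0 = (⟦ + 2 ⟧ℤ - proj₁ (x 0)) * E
  gap E x 1 = (⟦ + 2 ⟧ℤ - proj₁ (x 0)) * E
  gap E x 2 = proj₁ (x 0) * E
  gap E x 3 = proj₁ (x 0) * E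
  gap E x (suc (suc (suc (suc k)))) = gap (½ * E) (tail x) k

  node-gap : ∀ E x k → nodeAt E x k - nodeAt E x (suc k) ≈ gap E x k
  node-gap E x 0 = solve 2 (λ E x → con (+ 8) :* E :- (con (+ 6) :+ x) :* E := (con (+ 2) :- x) :* E) refl E (proj₁ (x 0))
  node-gap E x 1 = solve 2 (λ E x → (con (+ 6) :+ x) :* E :- (con (+ 4) :+ (x :+ x)) :* E := (con (+ 2) :- x) :* E) refl E (proj₁ (x 0))
  node-gap E x 2 = solve 2 (λ E x → (con (+ 4) :+ (x :+ x)) :* E :- (con (+ 4) :+ x) :* E := x :* E) refl E (proj₁ (x 0))
  -- The one gap that ends in the next block, whose top 8 (½ E) is the bottom 4 E of this one.
  node-gap E x 3 = ≈-byMultiple (⟦ + 4 ⟧ℤ * E) (sym ½+½≈1)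
    (solve 3 (λ E x h → x :* E :- ((con (+ 4) :+ x) :* E :- con (+ 8) :* (h :* E))
      := (con (+ 4) :* E) :* ((h :+ h) :- con (+ 1))) refl E (proj₁ (x 0)) ½)
  node-gap E x (suc (suc (suc (suc k)))) = node-gap (½ * E) (tail x) k

  0<2-x : ∀ (x : Space.Carrier ⟨0,1⟩) → 0# < ⟦ + 2 ⟧ℤ - proj₁ x
  0<2-x (x , _ , x<1) = x<y⇒0<y-x (<-trans x<1
    (<-byDifference 0<1 (solve 0 (con (+ 2) :- con (+ 1) := con (+ 1)) refl)))

  gap>0 : ∀ {E} → 0# < E → ∀ x k → 0# < gap E x k
  gap>0 0<E x 0 = 0<* (0<2-x (x 0)) 0<E
  gap>0 0<E x 1 = 0<* (0<2-x (x 0)) 0<E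
  gap>0 0<E x 2 = 0<* (proj₁ (proj₂ (x 0))) 0<E
  gap>0 0<E x 3 = 0<* (proj₁ (proj₂ (x 0))) 0<E
  gap>0 0<E x (suc (suc (suc (suc k)))) = gap>0 (0<* 0<½ 0<E) (tail x) k

  nodeAt>0 : ∀ {E} → 0# < E → ∀ x k → 0# < nodeAt E x k
  nodeAt>0 0<E x 0 = 0<* (0<suc 7) 0<E
  nodeAt>0 0<E x 1 = 0<* (0<+ (0<suc 5) (<⇒≤ (proj₁ (proj₂ (x 0))))) 0<E
  nodeAt>0 0<E x 2 = 0<* (0<+ (0<suc 3) (0≤+ (<⇒≤ (proj₁ (proj₂ (x 0)))) (<⇒≤ (proj₁ (proj₂ (x 0)))))) 0<E
  nodeAt>0 0<E x 3 = 0<* (0<+ (0<suc 3) (<⇒≤ (proj₁ (proj₂ (x 0))))) 0<E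
  nodeAt>0 0<E x (suc (suc (suc (suc k)))) = nodeAt>0 (0<* 0<½ 0<E) (tail x) k

  nodeAt-n*4 : ∀ E x n → nodeAt E x (n ℕ.* 4) ≡ ⟦ + 8 ⟧ℤ * halve E n
  nodeAt-n*4 E x zero = ≡.refl
  nodeAt-n*4 E x (suc n) = nodeAt-n*4 (½ * E) (tail x) n

  gap-2+n*4 : ∀ E x n → gap E x (2 ℕ.+ n ℕ.* 4) ≡ proj₁ (x n) * halve E n
  gap-2+n*4 E x zero = ≡.refl
  gap-2+n*4 E x (suc n) = gap-2+n*4 (½ * E) (tail x) n

  -- The slope of the k-th node as an affine function of the single coordinate `x (block k)` on
  -- which it depends.
  sensitivity : Carrier → ℕ → Carrier
  sensitivity E 0 = 0#
  sensitivity E 1 = E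
  sensitivity E 2 = E + E
  sensitivity E 3 = E
  sensitivity E (suc (suc (suc (suc k)))) = sensitivity (½ * E) k

  0≤sensitivity : ∀ {E} → 0# ≤ E → ∀ k → 0# ≤ sensitivity E k
  0≤sensitivity 0≤E 0 = ≤-refl
  0≤sensitivity 0≤E 1 = 0≤E
  0≤sensitivity 0≤E 2 = 0≤+ 0≤E 0≤E
  0≤sensitivity 0≤E 3 = 0≤E
  0≤sensitivity 0≤E (suc (suc (suc (suc k)))) = 0≤sensitivity (*-nonNeg (<⇒≤ 0<½) 0≤E) k

  nodeAt-affine : ∀ E x y k → nodeAt E y k - nodeAt E x k ≈
    sensitivity E k * (proj₁ (y (block k)) - proj₁ (x (block k)))
  nodeAt-affine E x y 0 = solve 3 (λ E x y → con (+ 8) :* E :- con (+ 8) :* E := con (+ 0) :* (y :- x)) refl E (proj₁ (x 0)) (proj₁ (y 0))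
  nodeAt-affine E x y 1 = solve 3 (λ E x y → (con (+ 6) :+ y) :* E :- (con (+ 6) :+ x) :* E := E :* (y :- x)) refl E (proj₁ (x 0)) (proj₁ (y 0))
  nodeAt-affine E x y 2 = solve 3 (λ E x y → (con (+ 4) :+ (y :+ y)) :* E :- (con (+ 4) :+ (x :+ x)) :* E := (E :+ E) :* (y :- x)) refl E (proj₁ (x 0)) (proj₁ (y 0))
  nodeAt-affine E x y 3 = solve 3 (λ E x y → (con (+ 4) :+ y) :* E :- (con (+ 4) :+ x) :* E := E :* (y :- x)) refl E (proj₁ (x 0)) (proj₁ (y 0))
  nodeAt-affine E x y (suc (suc (suc (suc k)))) = nodeAt-affine (½ * E) (tail x) (tail y) k

  weightAt : UnitSequence → UnitSequence → ℕ → Carrier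
  weightAt x y 1 = (⟦ + 2 ⟧ℤ - proj₁ (y 0)) * (⟦ + 2 ⟧ℤ - proj₁ (x 0)) ⁻¹
  weightAt x y 3 = proj₁ (y 0) * proj₁ (x 0) ⁻¹
  weightAt x y (suc (suc (suc (suc k)))) = weightAt (tail x) (tail y) k
  weightAt x y _ = 1#

  weightAt>0 : ∀ x y k → 0# < weightAt x y k
  weightAt>0 x y 0 = 0<1
  weightAt>0 x y 1 = 0<* (0<2-x (y 0)) (0<⁻¹ (0<2-x (x 0)))
  weightAt>0 x y 2 = 0<1
  weightAt>0 x y 3 = 0<* (proj₁ (proj₂ (y 0))) (0<⁻¹ (proj₁ (proj₂ (x 0))))
  weightAt>0 x y (suc (suc (suc (suc k)))) = weightAt>0 (tail x) (tail y) k

  private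
    rescale : ∀ {a} b E → 0# < a → b * E ≈ (a * E) * (b * a ⁻¹)
    rescale {a} b E 0<a = ≈-byMultiple (b * E) (sym (*-inverseʳ a (0<⇒≉0 0<a)))
      (solve 4 (λ a b E v → (a :* E) :* (b :* v) :- b :* E := (b :* E) :* (a :* v :- con (+ 1))) refl a b E (a ⁻¹))

  gap-weight : ∀ E x y k → gap E y k ≈ gap E x k * (weightAt x y k * weightAt x y (suc k))
  gap-weight E x y 0 = trans (rescale _ E (0<2-x (x 0))) (*-congˡ (sym (*-identityˡ _)))
  gap-weight E x y 1 = trans (rescale _ E (0<2-x (x 0))) (*-congˡ (sym (*-identityʳ _)))
  gap-weight E x y 2 = trans (rescale _ E (proj₁ (proj₂ (x 0)))) (*-congˡ (sym (*-identityˡ _)))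
  gap-weight E x y 3 = trans (rescale _ E (proj₁ (proj₂ (x 0)))) (*-congˡ (sym (*-identityʳ _)))
  gap-weight E x y (suc (suc (suc (suc k)))) = gap-weight (½ * E) (tail x) (tail y) k

  -- For the weight (2 - b) / (2 - a) the deviation is ∣a - b∣ / (2 - a). As a < 1, the divisor is
  -- at least a, which leaves at most ∣b / a - 1∣.
  weightAt-deviation : ∀ x y k → let n = block k in
    ∣ weightAt x y k - 1# ∣ ≤ ∣ proj₁ (y n) * proj₁ (x n) ⁻¹ - 1# ∣
  weightAt-deviation x y 0 = ≤-respˡ-≈ (sym (x≈y⇒∣x-y∣≈0 refl)) (0≤∣∣ _)
  weightAt-deviation x y 1 = quotient-estimate (0<⇒≉0 (0<2-x (x 0)))
    (≤-respˡ-≈ (trans (sym numerator) (∣x-y∣≈∣y-x∣ _ _))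
      (≤-respˡ-≈ (*-comm _ _) (*-monoˡ-≤ (0≤∣∣ _) a≤∣2-a∣)))
    where
    a = proj₁ (x 0)
    b = proj₁ (y 0)
    0<a : 0# < a
    0<a = proj₁ (proj₂ (x 0))
    numerator : ∣ 1# * (⟦ + 2 ⟧ℤ - a) - (⟦ + 2 ⟧ℤ - b) ∣ ≈ a * ∣ b * a ⁻¹ - 1# ∣
    numerator = trans (∣∣-cong (≈-byMultiple b (sym (*-inverseʳ a (0<⇒≉0 0<a)))
      (solve 3 (λ a b v → a :* (b :* v :- con (+ 1)) :- (con (+ 1) :* (con (+ 2) :- a) :- (con (+ 2) :- b))
        := b :* (a :* v :- con (+ 1))) refl a b (a ⁻¹)))) (∣x*y∣≈x*∣y∣ _ (<⇒≤ 0<a))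
    a≤∣2-a∣ : a ≤ ∣ ⟦ + 2 ⟧ℤ - a ∣
    a≤∣2-a∣ = ≤-trans (≤-byDifference (0≤+ (x≤y⇒0≤y-x (<⇒≤ (proj₂ (proj₂ (x 0))))) (x≤y⇒0≤y-x (<⇒≤ (proj₂ (proj₂ (x 0))))))
      (solve 1 (λ a → (con (+ 2) :- a) :- a := (con (+ 1) :- a) :+ (con (+ 1) :- a)) refl a)) (x≤∣x∣ _)
  weightAt-deviation x y 2 = ≤-respˡ-≈ (sym (x≈y⇒∣x-y∣≈0 refl)) (0≤∣∣ _)
  weightAt-deviation x y 3 = ≤-refl
  weightAt-deviation x y (suc (suc (suc (suc k)))) = weightAt-deviation (tail x) (tail y) k

  -- Makes the top node 8 E₀ equal to 1.
  E₀ : Carrier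
  E₀ = ⟦ + 8 ⟧ℤ ⁻¹

  0<E₀ : 0# < E₀
  0<E₀ = 0<⁻¹ (0<suc 7)

  -- One index serves all sequences, because block ends do not depend on them; continuity of the
  -- encoding rests on this uniformity.
  node-n*4-vanishing : ∀ ε → 0# < ε → Σ[ n ∈ ℕ ] (∀ x → nodeAt E₀ x (n ℕ.* 4) < ε)
  node-n*4-vanishing ε 0<ε =
    let δ , 0<δ , small = small-multiples (<⇒≤ (0<suc 7)) 0<ε
        n , lt = halve-vanishing 0<E₀ δ 0<δ
    in n , λ x → ≡.subst (_< ε) (≡.sym (nodeAt-n*4 E₀ x n)) (small _ lt (<⇒≤ (halve>0 0<E₀ n)))

  nodes : UnitSequence → Nodes
  nodes x = record
    { node       = nodeAt E₀ x
    ; node-zero  = *-inverseʳ _ (0<⇒≉0 (0<suc 7))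
    ; decreasing = λ k → <-byDifference (gap>0 0<E₀ x k) (node-gap E₀ x k)
    ; positive   = nodeAt>0 0<E₀ x
    ; vanishing  = λ ε 0<ε → let n , small = node-n*4-vanishing ε 0<ε in n ℕ.* 4 , small x
    }

  nodes-fixed : ∀ x y k → Σ[ i ∈ ℕ ] k ℕ.≤ i × nodeAt E₀ x i ≈ nodeAt E₀ y i
  nodes-fixed x y k = k ℕ.* 4 , ℕ.m≤m*n k 4 ,
    reflexive (≡.trans (nodeAt-n*4 E₀ x k) (≡.sym (nodeAt-n*4 E₀ y k)))

  -- The direction is from y to x because the deviation of `weightAt y x` is bounded by ∣x n / y n -
  -- 1∣, the quantity that `c₀×` controls.
  c₀×⇒transition : ∀ x y → c₀× x y → Transition (nodes y) (nodes x)
  c₀×⇒transition x y x∼y = record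
    { weight   = weightAt y x
    ; weight>0 = weightAt>0 y x
    ; steps    = λ k → trans (node-gap E₀ x k) (trans (gap-weight E₀ y x k) (*-congʳ (sym (node-gap E₀ y k))))
    ; weight→1 = λ ε 0<ε → let N , near = x∼y ε 0<ε
        in N ℕ.* 4 , λ k N*4≤k → ≤-<-trans (weightAt-deviation y x k) (near (block k) (n*4≤k⇒n≤block N k N*4≤k))
    ; fixed    = nodes-fixed y x
    }

-- Continuous maps are Borel

module _ {c i c′ i′ : Level} (X : Space c i) (Y : Space c′ i′) where
  private
    module X = Space X
    module Y = Space Y

  ContinuousAt : (X.Carrier → Y.Carrier) → X.Carrier → Y.Index → Set _
  ContinuousAt f x j = f x ∈ Y.subbasis j → Σ[ is ∈ List X.Index ]
    All (λ i → x ∈ X.subbasis i) is × (∀ {y} → All (λ i → y ∈ X.subbasis i) is → f y ∈ Y.subbasis j)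

  -- Continuity at subbasic sets passes to finite intersections by appending lists, and preimages
  -- commute with the operations generating the Borel sets.
  continuous⇒BorelMap : ∀ (f : X.Carrier → Y.Carrier) → (∀ x j → ContinuousAt f x j) → BorelMap X Y f
  continuous⇒BorelMap f continuous = preimage-Borel
    where
    preimage-All : ∀ x js → All (λ j → f x ∈ Y.subbasis j) js → Σ[ is ∈ List X.Index ]
      All (λ i → x ∈ X.subbasis i) is ×
      (∀ {y} → All (λ i → y ∈ X.subbasis i) is → All (λ j → f y ∈ Y.subbasis j) js)
    preimage-All x [] [] = [] , [] , λ _ → []
    preimage-All x (j ∷ js) (fx∈ ∷ fx∈s) =
      let is , x∈ , sub = continuous x j fx∈
          is′ , x∈′ , sub′ = preimage-All x js fx∈s
      in is ++ is′ , All.++⁺ x∈ x∈′ , λ y∈ → sub (All.++⁻ˡ is y∈) ∷ sub′ (All.++⁻ʳ is y∈)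

    preimage-open : ∀ {U} → Y.Open U → X.Open (f ⊢ U)
    preimage-open U-open {x} fx∈U =
      let js , fx∈ , sub = U-open fx∈U
          is , x∈ , sub′ = preimage-All x js fx∈
      in is , x∈ , λ y∈ → sub (sub′ y∈)

    preimage-Borel : ∀ {B} → Y.Borel B → X.Borel (f ⊢ B)
    preimage-Borel (Space.open-set U-open) = Space.open-set (preimage-open U-open)
    preimage-Borel (Space.complement B) = Space.complement (preimage-Borel B)
    preimage-Borel (Space.union Bs) = Space.union (λ n → preimage-Borel (Bs n))
    preimage-Borel (Space.extensional (A⊆B , B⊆A) A) =
      Space.extensional ((λ {x} → A⊆B {f x}) , (λ {x} → B⊆A {f x})) (preimage-Borel A)

-- Continuity of the encoding, and the reduction

module Topology (em : ∀ {ℓ} → ExcludedMiddle ℓ) (R : CompleteOrderedField) where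
  open OrderedField em R
  open Reals R
  open Interpolation em R
  open Diffeomorphisms em R
  open Encoding em R

  module _ (A : Pred Carrier 0ℓ) where
    private
      S : Space 0ℓ 0ℓ
      S = subspace ℝ A

    HasBall : Pred (Σ Carrier A) 0ℓ → Σ Carrier A → Set
    HasBall U x = Σ[ δ ∈ Carrier ] 0# < δ × (∀ (y : Σ Carrier A) → ∣ proj₁ y - proj₁ x ∣ < δ → y ∈ U)

    balls⇒open : ∀ {U} → (∀ x → x ∈ U → HasBall U x) → Space.Open S U
    balls⇒open ball {x} x∈U = let δ , 0<δ , sub = ball x x∈U in
      ((proj₁ x - δ , proj₁ x + δ) ∷ []) ,
      ((<-byDifference 0<δ (solve 2 (λ x d → x :- (x :- d) := d) refl (proj₁ x) δ) ,
        <-byDifference 0<δ (solve 2 (λ x d → (x :+ d) :- x := d) refl (proj₁ x) δ)) ∷ []) ,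
      λ { {y} ((l , h) ∷ []) → sub y (∣y-x∣<d h l) }

    interval-ball : ∀ js (x : Σ Carrier A) → All (λ j → x ∈ Space.subbasis S j) js →
      HasBall (λ y → All (λ j → y ∈ Space.subbasis S j) js) x
    interval-ball [] x [] = 1# , 0<1 , λ _ _ → []
    interval-ball ((a , b) ∷ js) x ((l , h) ∷ x∈s) =
      let δ₁ , 0<δ₁ , sub = interval-ball js x x∈s
          δ₂ , 0<δ₂ , δ₂≤l , δ₂≤h = min (x<y⇒0<y-x l) (x<y⇒0<y-x h)
          δ , 0<δ , δ≤δ₁ , δ≤δ₂ = min 0<δ₁ 0<δ₂
      in δ , 0<δ , λ y y~ →
           (within⇒above (≤-trans δ≤δ₂ δ₂≤l) y~ , within⇒below (≤-trans δ≤δ₂ δ₂≤h) y~) ∷ sub y (<-≤-trans y~ δ≤δ₁)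

    open⇒ball : ∀ {U} → Space.Open S U → ∀ x → x ∈ U → HasBall U x
    open⇒ball U-open x x∈U =
      let js , x∈ , sub = U-open x∈U
          δ , 0<δ , ball = interval-ball js x x∈
      in δ , 0<δ , λ y y~ → sub (ball y y~)

    -- An arbitrary predicate need not respect `≈`, but every ball around x contains the points
    -- equal to x.
    open-resp-≈ : ∀ {U} → Space.Open S U → ∀ x y → proj₁ x ≈ proj₁ y → x ∈ U → y ∈ U
    open-resp-≈ U-open x y x≈y x∈U = let δ , 0<δ , ball = open⇒ball U-open x x∈U
      in ball y (<-respˡ-≈ (sym (x≈y⇒∣x-y∣≈0 (sym x≈y))) 0<δ)

    ball : Carrier → Carrier → ∃ (Space.Open S)
    ball c r = (λ y → c - r < proj₁ y × proj₁ y < c + r) ,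
      λ where (l , h) → ((c - r , c + r) ∷ []) , ((l , h) ∷ []) , λ where (p ∷ []) → p

  unit-interval : Pred Carrier 0ℓ
  unit-interval x = 0# ≤ x × x ≤ 1#

  separated-from-nodes : ∀ P (t : Point) → ¬ nodePoints P t → ∀ K → Σ[ δ ∈ Carrier ] 0# < δ ×
    (∀ k → k ℕ.< K → δ ≤ ∣ Nodes.node P k - proj₁ t ∣)
  separated-from-nodes P t t∉ zero = 1# , 0<1 , λ k ()
  separated-from-nodes P t t∉ (suc K) =
    let δ₁ , 0<δ₁ , far = separated-from-nodes P t t∉ K
        δ , 0<δ , δ≤δ₁ , δ≤ = min 0<δ₁ (0<∣x∣ (x≉y⇒x-y≉0 λ eq → t∉ (inj₂ (K , sym eq))))
    in δ , 0<δ , λ k k≤K → separated k (ℕ.m≤n⇒m<n∨m≡n (ℕ.≤-pred k≤K)) (λ k<K → ≤-trans δ≤δ₁ (far k k<K)) δ≤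
    where
    separated : ∀ {δ} k → k ℕ.< K ⊎ k ≡ K → (k ℕ.< K → δ ≤ ∣ Nodes.node P k - proj₁ t ∣) →
      δ ≤ ∣ Nodes.node P K - proj₁ t ∣ → δ ≤ ∣ Nodes.node P k - proj₁ t ∣
    separated k (inj₁ k<K) far _ = far k<K
    separated k (inj₂ ≡.refl) _ le = le

  -- A point t outside the set is positive. From some index on the nodes lie below t / 2, and the
  -- finitely many earlier ones are at a positive distance from t.
  nodePoints-closed : ∀ P → Space.Open [0,1] (∁ (nodePoints P))
  nodePoints-closed P {t} = balls⇒open unit-interval {∁ (nodePoints P)} complement-ball {t}
    where
    open Nodes P
    complement-ball : ∀ t → ¬ nodePoints P t → HasBall unit-interval (∁ (nodePoints P)) t
    complement-ball t t∉ =
      let K , nodeK<½t = vanishing (½ * proj₁ t) (0<* 0<½ 0<t)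
          δ₁ , 0<δ₁ , far = separated-from-nodes P t t∉ K
          δ , 0<δ , δ≤δ₁ , δ≤½t = min 0<δ₁ (0<* 0<½ 0<t)
      in δ , 0<δ , λ y y~ → outside K nodeK<½t (λ k k<K → ≤-trans δ≤δ₁ (far k k<K)) δ≤½t y y~
      where
      0<t : 0# < proj₁ t
      0<t = proj₁ (proj₂ t) , λ 0≈t → t∉ (inj₁ (sym 0≈t))
      outside : ∀ {δ} K → node K < ½ * proj₁ t → (∀ k → k ℕ.< K → δ ≤ ∣ node k - proj₁ t ∣) → δ ≤ ½ * proj₁ t →
        ∀ y → ∣ proj₁ y - proj₁ t ∣ < δ → ¬ nodePoints P y
      outside {δ} K nodeK<½t far δ≤½t y y~ = λ where
          (inj₁ y≈0) → <⇒≱ ½t<y (≤-respˡ-≈ (sym y≈0) (<⇒≤ (0<* 0<½ 0<t)))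
          (inj₂ (k , y≈p)) → at-node k y≈p
        where
        ½t<y : ½ * proj₁ t < proj₁ y
        ½t<y = within⇒above (≤-trans δ≤½t (≤-reflexive (≈-byMultiple 1# (½*+½* (proj₁ t))
          (solve 2 (λ h t → (t :- h) :- h := con (+ 1) :* (t :- (h :+ h))) refl (½ * proj₁ t) (proj₁ t))))) y~
        at-node : ∀ k → proj₁ y ≈ node k → ⊥
        at-node k y≈p with ℕ.<-≤-connex k K
        ... | inj₁ k<K = <⇒≱ y~ (≤-respʳ-≈ (∣∣-cong (+-congʳ (sym y≈p))) (far k k<K))
        ... | inj₂ K≤k = <⇒≱ (≤-<-trans (≤-respˡ-≈ (sym y≈p) (antitone K≤k)) nodeK<½t) (<⇒≤ ½t<y)

  encode : UnitSequence → ClosedSet [0,1]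
  encode x = record { points = nodePoints (nodes x) ; closed = λ {t} → nodePoints-closed (nodes x) {t} }

  encode-cong : ∀ {x y : UnitSequence} → (∀ n → proj₁ (x n) ≈ proj₁ (y n)) →
    nodePoints (nodes x) ≐ nodePoints (nodes y)
  encode-cong {x} {y} x≈y = (λ {t} → ⊆ x y x≈y t) , (λ {t} → ⊆ y x (λ n → sym (x≈y n)) t)
    where
    ⊆ : ∀ x y → (∀ n → proj₁ (x n) ≈ proj₁ (y n)) → ∀ t → nodePoints (nodes x) t → nodePoints (nodes y) t
    ⊆ x y x≈y t (inj₁ t≈0) = inj₁ t≈0
    ⊆ x y x≈y t (inj₂ (k , t≈p)) = inj₂ (k , trans t≈p (y-x≈0⇒x≈y (trans (nodeAt-affine E₀ x y k)
      (trans (*-congˡ (trans (+-congʳ (sym (x≈y (block k)))) (-‿inverseʳ _))) (zeroʳ _)))))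

  private
    module 𝕏 = Space (⟨0,1⟩ ^ℕ)
    module 𝕐 = Space 𝓕[0,1]

  node-continuous : ∀ x k {U} → Space.Open [0,1] U → Nodes.node-point (nodes x) k ∈ U → Σ[ i ∈ 𝕏.Index ]
    x ∈ 𝕏.subbasis i × (∀ y → y ∈ 𝕏.subbasis i → Nodes.node-point (nodes y) k ∈ U)
  node-continuous x k {U} U-open p∈U =
    let δ , 0<δ , sub = open⇒ball unit-interval {U} U-open _ p∈U
        r , 0<r , small = small-multiples (0≤sensitivity (<⇒≤ 0<E₀) k) 0<δ
        c = proj₁ (x (block k))
    in (block k , ball _ c r) ,
       (<-byDifference 0<r (solve 2 (λ x d → x :- (x :- d) := d) refl c r) ,
        <-byDifference 0<r (solve 2 (λ x d → (x :+ d) :- x := d) refl c r)) ,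
       λ y (l , h) → sub (Nodes.node-point (nodes y) k)
         (<-respˡ-≈ (sym (trans (∣∣-cong (nodeAt-affine E₀ x y k))
             (∣x*y∣≈x*∣y∣ _ (0≤sensitivity (<⇒≤ 0<E₀) k))))
           (small _ (∣y-x∣<d h l) (0≤∣∣ _)))

  nodes-continuous : ∀ x {U} → Space.Open [0,1] U → (∀ k → Nodes.node-point (nodes x) k ∈ U) →
    ∀ K → Σ[ is ∈ List 𝕏.Index ] All (λ i → x ∈ 𝕏.subbasis i) is ×
      (∀ y → All (λ i → y ∈ 𝕏.subbasis i) is → ∀ k → k ℕ.< K → Nodes.node-point (nodes y) k ∈ U)
  nodes-continuous x U-open p∈U zero = [] , [] , λ y _ k ()
  nodes-continuous x {U} U-open p∈U (suc K) =
    let i , x∈ , sub = node-continuous x K {U} U-open (p∈U K)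
        is , x∈s , subs = nodes-continuous x {U} U-open p∈U K
    in i ∷ is , x∈ ∷ x∈s , λ where
         y (y∈ ∷ y∈s) k k≤K → extend y k (ℕ.m≤n⇒m<n∨m≡n (ℕ.≤-pred k≤K)) (subs y y∈s k) (sub y y∈)
    where
    extend : ∀ y k → k ℕ.< K ⊎ k ≡ K → (k ℕ.< K → Nodes.node-point (nodes y) k ∈ U) →
      Nodes.node-point (nodes y) K ∈ U → Nodes.node-point (nodes y) k ∈ U
    extend y k (inj₁ k<K) before _ = before k<K
    extend y k (inj₂ ≡.refl) _ at = at

  -- If the set lies in U, then U contains a ball around 0, and from one block end on the nodes of
  -- every sequence are in that ball; only finitely many nodes remain to be kept in U. If the set
  -- meets U, it is enough to follow one node.
  encode-continuous : ∀ x j → ContinuousAt (⟨0,1⟩ ^ℕ) 𝓕[0,1] encode x j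
  encode-continuous x (inj₁ (U , U-open)) Fx⊆U =
    from-ball (open⇒ball unit-interval {U} U-open zero-point (Fx⊆U (inj₁ refl)))
    where
    Goal : Set₁
    Goal = Σ[ is ∈ List 𝕏.Index ] All (λ i → x ∈ 𝕏.subbasis i) is ×
      (∀ {y} → All (λ i → y ∈ 𝕏.subbasis i) is → ∀ {t} → nodePoints (nodes y) t → t ∈ U)

    module _ (δ : Carrier) (0<δ : 0# < δ) (sub : ∀ (t : Point) → ∣ proj₁ t - 0# ∣ < δ → t ∈ U) where
      contained : ∀ y (t : Point) K → nodeAt E₀ y K < δ →
        (∀ k → k ℕ.< K → Nodes.node-point (nodes y) k ∈ U) →
        ∀ k → proj₁ t ≈ nodeAt E₀ y k → k ℕ.< K ⊎ K ℕ.≤ k → t ∈ U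
      contained y t K small nodes∈ k t≈p (inj₁ k<K) =
        open-resp-≈ unit-interval {U} U-open (Nodes.node-point (nodes y) k) t (sym t≈p) (nodes∈ k k<K)
      contained y t K small nodes∈ k t≈p (inj₂ K≤k) =
        sub t (<-respˡ-≈ (sym (y≈0⇒∣x-y∣≈x refl (proj₁ (proj₂ t))))
          (≤-<-trans (≤-respˡ-≈ (sym t≈p) (Nodes.antitone (nodes y) K≤k)) small))

      from-vanishing : Σ[ n ∈ ℕ ] (∀ y → nodeAt E₀ y (n ℕ.* 4) < δ) → Goal
      from-vanishing (n , small) =
        let is , x∈ , nodes∈ = nodes-continuous x {U} U-open (λ k → Fx⊆U (inj₂ (k , refl))) (n ℕ.* 4)
        in is , x∈ , λ where
             y∈ {t} (inj₁ t≈0) → sub t (<-respˡ-≈ (sym (x≈y⇒∣x-y∣≈0 t≈0)) 0<δ)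
             {y} y∈ {t} (inj₂ (k , t≈p)) →
               contained y t (n ℕ.* 4) (small y) (nodes∈ y y∈) k t≈p (ℕ.<-≤-connex k (n ℕ.* 4))

    from-ball : HasBall unit-interval U zero-point → Goal
    from-ball (δ , 0<δ , sub) = from-vanishing δ 0<δ sub (node-n*4-vanishing δ 0<δ)
  -- The point 0 lies in every encoding, so the empty list of conditions, the whole space, is a
  -- neighbourhood that works.
  encode-continuous x (inj₂ (U , U-open)) (t , inj₁ t≈0 , t∈U) = [] , [] , λ _ → t , inj₁ t≈0 , t∈U
  encode-continuous x (inj₂ (U , U-open)) (t , inj₂ (k , t≈p) , t∈U) =
    let i , x∈ , sub = node-continuous x k {U} U-open
          (open-resp-≈ unit-interval {U} U-open t (Nodes.node-point (nodes x) k) t≈p t∈U)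
    in i ∷ [] , x∈ ∷ [] , λ { {y} (y∈ ∷ []) → Nodes.node-point (nodes y) k , inj₂ (k , refl) , sub y y∈ }

  -- Gap number 2 + 4 n has length x n h in one set and y n h in the other, so in the ratio of
  -- corresponding gaps the scale h cancels.
  equivalent⇒c₀× : ∀ x y → E^H-Diff (encode x) (encode y) → c₀× x y
  equivalent⇒c₀× x y (g , g-image) ε 0<ε =
    let K , near = steps-asymptotic {nodes x} {nodes y} g g-image (nodes-fixed x y) (½ * ε) (0<* 0<½ 0<ε)
    in K , λ n K≤n → ≤-<-trans
         (ratio n (near (2 ℕ.+ n ℕ.* 4) (ℕ.≤-trans K≤n (ℕ.≤-trans (ℕ.m≤m*n n 4) (ℕ.m≤n+m _ 2))))) (½*< 0<ε)
    where
    ratio : ∀ n → let k = 2 ℕ.+ n ℕ.* 4 in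
      AlmostIsometric (½ * ε) (nodeAt E₀ y k) (nodeAt E₀ x k) (nodeAt E₀ y (suc k)) (nodeAt E₀ x (suc k)) →
      ∣ proj₁ (x n) * proj₁ (y n) ⁻¹ - 1# ∣ ≤ ½ * ε
    ratio n almost = quotient-estimate (0<⇒≉0 0<y) (*-cancelˡ-≤ 0<h
      (≤-respˡ-≈ (trans (∣∣-cong (trans (+-cong (step x) (-‿cong (step y)))
          (solve 3 (λ a b h → a :* h :- b :* h := h :* (a :- con (+ 1) :* b)) refl (proj₁ (x n)) (proj₁ (y n)) h)))
          (∣x*y∣≈x*∣y∣ _ (<⇒≤ 0<h)))
        (≤-respʳ-≈ (trans (*-congˡ (step y)) (trans
            (solve 3 (λ e b h → e :* (b :* h) := h :* (e :* b)) refl (½ * ε) (proj₁ (y n)) h)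
            (*-congˡ (*-congˡ (sym (0≤x⇒∣x∣≈x (<⇒≤ 0<y)))))))
          almost)))
      where
      h = halve E₀ n
      0<h : 0# < h
      0<h = halve>0 0<E₀ n
      0<y : 0# < proj₁ (y n)
      0<y = proj₁ (proj₂ (y n))
      step : ∀ z → nodeAt E₀ z (2 ℕ.+ n ℕ.* 4) - nodeAt E₀ z (3 ℕ.+ n ℕ.* 4) ≈ proj₁ (z n) * h
      step z = trans (node-gap E₀ z (2 ℕ.+ n ℕ.* 4)) (reflexive (gap-2+n*4 E₀ z n))

theorem3p17 : (∀ {ℓ} → ExcludedMiddle ℓ) → (R : CompleteOrderedField) →
    let open Reals R in [ ⟨0,1⟩ ^ℕ , c₀× ]≤B[ 𝓕[0,1] , E^H-Diff ]
theorem3p17 em R =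
  record { to = encode ; cong = encode-cong } ,
  continuous⇒BorelMap (⟨0,1⟩ ^ℕ) 𝓕[0,1] encode encode-continuous ,
  λ x y → mk⇔
    (λ x∼y → transition⇒equivalent (swap (c₀×⇒transition x y x∼y)))
    (equivalent⇒c₀× x y)
  where
  open Reals R
  open Interpolation em R
  open Diffeomorphisms em R
  open Encoding em R
  open Topology em R
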